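{- Let $\mathbb{F}_q$ be a finite field with $q\equiv 1\pmod 3$. Then there exist exactly $$\frac{q+12-(q \bmod 12)}{12}$$ isomorphism classes (over $\mathbb{F}_q$) of elliptic curves $E$ over $\mathbb{F}_q$ whose group $E(\mathbb{F}_q)[3]$ of rational $3$-torsion points is non-cyclic.
   Context: Here $q \bmod 12$ denotes the remainder in $\{0,\dots,11\}$ of the division of $q$ by $12$. -}

module Defs where

open import Algebra.Apartness.Bundles using (HeytingField; HeytingCommutativeRing)
open import Algebra.Bundles using (CommutativeRing; Semiring)
open import Algebra.Bundles.Raw using (RawGroup)
import Algebra.Definitions.RawMonoid as RawMonoidDefinitions
import Algebra.Definitions.RawSemiring as RawSemiringDefinitions
open import Data.Fin.Base using (Fin)
import Data.Fin.Properties as Fin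
open import Data.Integer.Base using (ℤ; +_; -[1+_])
open import Data.Maybe.Base using (Maybe; just; nothing)
import Data.Maybe.Relation.Binary.Pointwise as Maybe
open import Data.Maybe.Relation.Unary.All using (All)
open import Data.Nat.Base using (ℕ; suc)
open import Data.Product.Base using (Σ; ∃; _×_; _,_)
import Data.Product.Relation.Binary.Pointwise.NonDependent as Product
open import Function.Bundles using (Inverse)
open import Function.Definitions using (Congruent; Bijective)
open import Function.Properties.Inverse using (Inverse⇒Injection)
open import Level using (Level; _⊔_) renaming (suc to lsuc)
open import Relation.Binary.Core using (Rel)
open import Relation.Binary.Definitions using (Decidable)
open import Relation.Binary.PropositionalEquality as ≡ using (_≡_)
open import Relation.Nullary.Decidable using (yes; no; via-injection)
open import Relation.Nullary.Negation using (¬_)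
open import Relation.Unary using (Pred; _∈_)

private
  variable
    a c p ℓ ℓ₁ ℓ₂ : Level

-- The relation _≈_ is not required beforehand to be an equivalence, but a
-- witness makes it the kernel of a function, hence one; Fin n is then the
-- quotient of A by _≈_.
HasExactlyClasses : {A : Set a} → Rel A ℓ → ℕ → Set (a ⊔ ℓ)
HasExactlyClasses {A = A} _≈_ n =
  ∃ λ (f : A → Fin n) → Congruent _≈_ _≡_ f × Bijective _≈_ _≡_ f

module _ (G : RawGroup c ℓ) where

  open RawGroup G
  open RawMonoidDefinitions rawMonoid using () renaming (_×_ to _·_)

  power : ℤ → Carrier → Carrier
  power (+ n)      g = n · g
  power (-[1+ n ]) g = (suc n · g) ⁻¹

  Cyclic : Pred Carrier p → Set (c ⊔ ℓ ⊔ p)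
  Cyclic H = ∃ λ g → g ∈ H × (∀ h → h ∈ H → ∃ λ k → power k g ≈ h)

-- Since equality and invertibility are decidable on an enumerated ring, every
-- x ≉ 0# is invertible here, as in the classical definition of a field.
record FiniteField c ℓ₁ ℓ₂ : Set (lsuc (c ⊔ ℓ₁ ⊔ ℓ₂)) where
  field
    heytingField : HeytingField c ℓ₁ ℓ₂

  open HeytingField heytingField public

  field
    order       : ℕ
    enumeration : Inverse setoid (≡.setoid (Fin order))

  infix 4 _≟_
  _≟_ : Decidable _≈_
  _≟_ = via-injection (Inverse⇒Injection enumeration) Fin._≟_

  -- Inversion by exhaustive search, with the convention 0# ⁻¹ = 0#.
  infix 9 _⁻¹
  _⁻¹ : Carrier → Carrier
  x ⁻¹ with Fin.any? (λ i → x * Inverse.from enumeration i ≟ 1#)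
  ... | yes (i , _) = Inverse.from enumeration i
  ... | no  _       = 0#

module EllipticCurves (F : FiniteField c ℓ₁ ℓ₂) where

  open FiniteField F
  open CommutativeRing (HeytingCommutativeRing.commutativeRing heytingCommutativeRing)
    using () renaming (semiring to F-semiring)
  open RawSemiringDefinitions (Semiring.rawSemiring F-semiring) using (_^_) renaming (_×_ to _·_)

  -- y² + a₁xy + a₃y = x³ + a₂x² + a₄x + a₆.  The characteristic may be 2, so
  -- no shorter normal form is available.
  record WeierstrassEquation : Set c where
    field
      a₁ a₂ a₃ a₄ a₆ : Carrier

    b₂ b₄ b₆ b₈ Δ : Carrier
    b₂ = a₁ ^ 2 + 4 · a₂
    b₄ = 2 · a₄ + a₁ * a₃
    b₆ = a₃ ^ 2 + 4 · a₆
    b₈ = a₁ ^ 2 * a₆ + 4 · (a₂ * a₆) - a₁ * a₃ * a₄ + a₂ * a₃ ^ 2 - a₄ ^ 2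
    Δ  = - (b₂ ^ 2 * b₈) - 8 · b₄ ^ 3 - 27 · b₆ ^ 2 + 9 · (b₂ * b₄ * b₆)

  record EllipticCurve : Set (c ⊔ ℓ₁) where
    field
      equation : WeierstrassEquation

    open WeierstrassEquation equation public

    field
      nonsingular : ¬ (Δ ≈ 0#)

  -- nothing is the point at infinity.
  Point : Set c
  Point = Maybe (Carrier × Carrier)

  module _ (E : EllipticCurve) where

    open EllipticCurve E

    OnCurve : Pred Point (c ⊔ ℓ₁)
    OnCurve = All λ (x , y) →
      y ^ 2 + a₁ * x * y + a₃ * y ≈ x ^ 3 + a₂ * x ^ 2 + a₄ * x + a₆

    negate : Point → Point
    negate nothing        = nothing
    negate (just (x , y)) = just (x , - y - a₁ * x - a₃)

    -- The third point of the line of slope m through (x₁ , y₁) and a point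
    -- with abscissa x₂, reflected by negate.
    chord : (m x₁ y₁ x₂ : Carrier) → Point
    chord m x₁ y₁ x₂ = negate (just (x₃ , y₁ + m * (x₃ - x₁)))
      where
      x₃ : Carrier
      x₃ = m ^ 2 + a₁ * m - a₂ - x₁ - x₂

    -- The chord-tangent law, meaningful for points on the curve.  In the last
    -- case such points with x₁ ≈ x₂ that are not opposite are equal.
    add : Point → Point → Point
    add nothing          Q                = Q
    add (just P)         nothing          = just P
    add (just (x₁ , y₁)) (just (x₂ , y₂)) with x₁ ≟ x₂
    ... | no _ = chord ((y₂ - y₁) * (x₂ - x₁) ⁻¹) x₁ y₁ x₂
    ... | yes _ with y₁ + y₂ + a₁ * x₂ + a₃ ≟ 0#
    ...   | yes _ = nothing
    ...   | no  _ = chord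
      ((3 · x₁ ^ 2 + 2 · (a₂ * x₁) + a₄ - a₁ * y₁) * (2 · y₁ + a₁ * x₁ + a₃) ⁻¹)
      x₁ y₁ x₂

    rawGroup : RawGroup c (c ⊔ ℓ₁)
    rawGroup = record
      { Carrier = Point
      ; _≈_     = Maybe.Pointwise (Product.Pointwise _≈_ _≈_)
      ; _∙_     = add
      ; ε       = nothing
      ; _⁻¹     = negate
      }

    Torsion : ℕ → Pred Point (c ⊔ ℓ₁)
    Torsion n P = OnCurve P × power rawGroup (+ n) P ≈ₚ nothing
      where open RawGroup rawGroup using () renaming (_≈_ to _≈ₚ_)

  infix 4 _≅_ _≅₃_

  -- E ≅ E′: substituting x = u²x′ + r, y = u³y′ + su²x′ + t in the equation of
  -- E and dividing by u⁶ gives the equation of E′.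
  record _≅_ (E E′ : EllipticCurve) : Set (c ⊔ ℓ₁) where
    open EllipticCurve E
    open EllipticCurve E′ using () renaming
      (a₁ to a₁′; a₂ to a₂′; a₃ to a₃′; a₄ to a₄′; a₆ to a₆′)
    field
      u r s t : Carrier
      u≉0 : ¬ (u ≈ 0#)
      eq₁ : u     * a₁′ ≈ a₁ + 2 · s
      eq₂ : u ^ 2 * a₂′ ≈ a₂ - s * a₁ + 3 · r - s ^ 2
      eq₃ : u ^ 3 * a₃′ ≈ a₃ + r * a₁ + 2 · t
      eq₄ : u ^ 4 * a₄′ ≈ a₄ - s * a₃ + 2 · (r * a₂) - (t + r * s) * a₁
                          + 3 · r ^ 2 - 2 · (s * t)
      eq₆ : u ^ 6 * a₆′ ≈ a₆ + r * a₄ + r ^ 2 * a₂ + r ^ 3 - t * a₃ - t ^ 2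
                          - r * t * a₁

  NonCyclic3Torsion : Set (c ⊔ ℓ₁)
  NonCyclic3Torsion = Σ EllipticCurve λ E → ¬ Cyclic (rawGroup E) (Torsion E 3)

  _≅₃_ : Rel NonCyclic3Torsion (c ⊔ ℓ₁)
  (E , _) ≅₃ (E′ , _) = E ≅ E′

{-# OPTIONS --safe #-}
module Submission where

-- A point at which the tangent meets the curve in no other point is moved to
-- (0 , 0) with tangent y = 0, which gives y² + αxy + βy = x³. A second 3-torsion
-- point, not opposite to it, exists exactly when α³ - 27β is a cube w³ (cube roots
-- of unity are at hand), and scaling w to 3 gives the member with parameter
-- l = α/w of the Hesse pencil y² + 3lxy + (l³ - 1)y = x³, l³ ≠ 1, whose j-invariant
-- is 27v³ with v = l(l³ + 8)/(l³ - 1). Members with the same v³ are isomorphic: the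
-- group of order 12 generated by l ↦ ωl and l ↦ (l + 2)/(l - 1) acts transitively on
-- them. If n is the number of nonzero values of v³, then every l is one of 12n
-- images of representatives or one of the seven solutions of l(l³ + 8)(l³ - 1) = 0,
-- so that q ≤ 12n + 7. Conversely 12n ≤ q, since these images are distinct except
-- over j = 1728, where the missing six are replaced by the solutions of l³ = 1 and
-- l³ = -8. Hence n = ⌊q/12⌋, and l = 0 gives one more class.

open import Defs
open import Algebra.Apartness.Bundles using (HeytingCommutativeRing)
open import Algebra.Bundles using (CommutativeRing; Semiring)
open import Algebra.Bundles.Raw using (RawGroup)
import Algebra.Definitions.RawSemiring as RawSemiringDefinitions
import Algebra.Properties.AbelianGroup as AbelianGroupProperties
import Algebra.Properties.Monoid.Mult.TCOptimised as Multiples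
import Algebra.Properties.Ring as RingProperties
import Algebra.Properties.Semiring.Mult.TCOptimised as SemiringMultiples
import Algebra.Solver.Ring as RingSolver
open import Algebra.Solver.Ring.AlmostCommutativeRing using (fromCommutativeRing; _-Raw-AlmostCommutative⟶_)
open import Data.Bool.Base using (T)
open import Data.Fin.Base as Fin using (Fin; zero; suc)
import Data.Fin.Properties as Fin
open import Data.Integer.Base as ℤ using (ℤ; +_; -[1+_]; +[1+_]; _⊖_)
import Data.Integer.Properties as ℤ
open import Data.Maybe.Base as Maybe using (Maybe; just; nothing; is-just)
open import Data.Maybe.Relation.Binary.Pointwise using (just; nothing)
open import Data.Maybe.Relation.Unary.All using (All; just; nothing)
open import Data.Nat.Base as ℕ using (ℕ; zero; suc)
open import Data.Nat.Divisibility using (_∣_; divides; n∣m⇒m%n≡0)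
open import Data.Nat.DivMod using (_/_; _%_)
import Data.Nat.DivMod as ℕ
import Data.Nat.Properties as ℕ
open import Data.Product.Base as Product using (Σ; ∃; _×_; _,_; proj₁; proj₂)
open import Data.Sum.Base as Sum using (_⊎_; inj₁; inj₂)
open import Data.Vec.Base as Vec using (Vec; []; _∷_)
open import Data.Vec.N-ary using (N-ary; Eq; _$ⁿ_; curryⁿ; curryⁿ-cong)
open import Data.Vec.Relation.Binary.Pointwise.Inductive as Pointwise using (Pointwise; []; _∷_)
open import Function.Bundles using (Inverse)
open import Function.Definitions using (Injective; StrictlySurjective)
open import Level using (Level; _⊔_)
open import Relation.Binary.Core using (Rel)
open import Relation.Binary.PropositionalEquality as ≡ using (_≡_)
import Relation.Binary.Reasoning.Setoid as SetoidReasoning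
open import Relation.Nullary.Decidable using (Dec; yes; no; dec⇒maybe; map′; _×-dec_; ¬?)
open import Relation.Nullary.Negation using (¬_; contradiction)
open import Relation.Unary as Unary using (Pred)

-- The function v comes from j = c₄³/Δ: on the member with parameter l, c₄ is 9l(l³ + 8) and Δ is
-- 27(l³ - 1)³, so that j is 27 times the cube of a function of degree four. Twelve is thus three
-- choices of a cube root of v³ times four points in a fibre of v. The obstacle is ramification.
-- Over v = 4ζ the quartic becomes the square (l² - 2ζl - 2ζ²)², so the orbit of such an l has only
-- six elements. In characteristic 2 these v are zero, and the case disappears by itself. Otherwise
-- all characteristics except 3 share one argument: algebraic facts are identities over ℤ in which
-- the hypotheses appear with explicit cofactors. The congruence of q enters only through 1/3 and a
-- primitive cube root of unity ω. Both are found by counting orbits of a map of order 3: x ↦ x + 1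
-- on the field, and x ↦ 1/(1 - x) on the projective line, whose fixed points are the negatives of
-- the primitive cube roots of unity.

private
  variable
    c ℓ ℓ₁ ℓ₂ p : Level

-- Counting in finite sets.

record Enumeration {m} (P : Pred (Fin m) p) : Set p where
  field
    size      : ℕ
    element   : Fin size → Fin m
    injective : Injective _≡_ _≡_ element
    satisfies : ∀ i → P (element i)
    complete  : ∀ {x} → P x → ∃ λ i → element i ≡ x

enumerate : ∀ {m} {P : Pred (Fin m) p} → Unary.Decidable P → Enumeration P
enumerate {m = zero}  P? = record
  { size      = 0
  ; element   = λ ()
  ; injective = λ { {()} }
  ; satisfies = λ ()
  ; complete  = λ { {()} }
  }
enumerate {m = suc m} {P = P} P? with enumerate (λ i → P? (suc i)) | P? zero
... | tail | no ¬P0 = record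
  { size      = size
  ; element   = λ i → suc (element i)
  ; injective = λ eq → injective (Fin.suc-injective eq)
  ; satisfies = satisfies
  ; complete  = λ
    { {zero}  P0 → contradiction P0 ¬P0
    ; {suc x} Px → Product.map₂ (≡.cong suc) (complete Px)
    }
  }
  where open Enumeration tail
... | tail | yes P0 = record
  { size      = suc size
  ; element   = λ { zero → zero ; (suc i) → suc (element i) }
  ; injective = λ
    { {zero}  {zero}  _  → ≡.refl
    ; {suc i} {suc j} eq → ≡.cong suc (injective (Fin.suc-injective eq))
    }
  ; satisfies = λ { zero → P0 ; (suc i) → satisfies i }
  ; complete  = λ
    { {zero}  _  → zero , ≡.refl
    ; {suc x} Px → Product.map suc (≡.cong suc) (complete Px)
    }
  }
  where open Enumeration tail

injection⇒*-≤ : ∀ {a b m} (f : Fin a → Fin b → Fin m) →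
  (∀ {i j i′ j′} → f i j ≡ f i′ j′ → i ≡ i′ × j ≡ j′) → a ℕ.* b ℕ.≤ m
injection⇒*-≤ {a} {b} f f-injective =
  Fin.injective⇒≤ {f = λ k → Product.uncurry f (Fin.remQuot {a} b k)} λ {k} {k′} eq →
  let i≡i′ , j≡j′ = f-injective eq in
  ≡.trans (≡.sym (Fin.combine-remQuot {a} b k))
    (≡.trans (≡.cong₂ Fin.combine i≡i′ j≡j′) (Fin.combine-remQuot {a} b k′))

surjection⇒≤ : ∀ {m n} (f : Fin m → Fin n) → StrictlySurjective _≡_ f → n ℕ.≤ m
surjection⇒≤ f surj = Fin.injective⇒≤ {f = λ y → proj₁ (surj y)} λ {y} {y′} eq →
  ≡.trans (≡.sym (proj₂ (surj y))) (≡.trans (≡.cong f eq) (proj₂ (surj y′)))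

-- The `r` leftovers are the elements outside a family of `a` blocks of size `b`: none for the
-- orbits of a free map, seven for the parameters of the pencil.
surjection⇒≤-*+ : ∀ {a b r m} (f : Fin a → Fin b → Fin m) (g : Fin r → Fin m) →
  (∀ x → (∃ λ i → ∃ λ j → f i j ≡ x) ⊎ (∃ λ i → g i ≡ x)) → m ℕ.≤ a ℕ.* b ℕ.+ r
surjection⇒≤-*+ {a} {b} {r} f g cover = surjection⇒≤ decode surjective
  where
  decode : Fin (a ℕ.* b ℕ.+ r) → Fin _
  decode k = Sum.[ (λ i → Product.uncurry f (Fin.remQuot b i)) , g ]′ (Fin.splitAt (a ℕ.* b) k)

  surjective : StrictlySurjective _≡_ decode
  surjective x with cover x
  ... | inj₁ (i , j , eq) = Fin.combine i j Fin.↑ˡ r , ≡.trans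
    (≡.cong Sum.[ _ , g ]′ (Fin.splitAt-↑ˡ (a ℕ.* b) (Fin.combine i j) r))
    (≡.trans (≡.cong (Product.uncurry f) (Fin.remQuot-combine i j)) eq)
  ... | inj₂ (i , eq) = (a ℕ.* b) Fin.↑ʳ i , ≡.trans
    (≡.cong Sum.[ (λ i → Product.uncurry f (Fin.remQuot b i)) , g ]′ (Fin.splitAt-↑ʳ (a ℕ.* b) r i)) eq

-- Orbits of a fixed-point-free map of order 3.

module FreeOrder3 {m} (ρ : Fin m → Fin m)
  (ρ³≡id : ∀ i → ρ (ρ (ρ i)) ≡ i) (ρ-free : ∀ i → ¬ (ρ i ≡ i)) where

  -- Orbits are represented by their least elements.
  Least : Pred (Fin m) _
  Least i = i Fin.≤ ρ i × i Fin.≤ ρ (ρ i)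

  open Enumeration (enumerate {P = Least} (λ i → (i Fin.≤? ρ i) ×-dec (i Fin.≤? ρ (ρ i))))

  power-ρ : Fin 3 → Fin m → Fin m
  power-ρ zero             i = i
  power-ρ (suc zero)       i = ρ i
  power-ρ (suc (suc zero)) i = ρ (ρ i)

  ρ-injective : ∀ {i j} → ρ i ≡ ρ j → i ≡ j
  ρ-injective {i} {j} eq =
    ≡.trans (≡.sym (ρ³≡id i)) (≡.trans (≡.cong (λ k → ρ (ρ k)) eq) (ρ³≡id j))

  -- Two least elements of one orbit bound each other, and antisymmetry would make `i` a fixed
  -- point.
  least-step : ∀ {i j} → Least i → Least j → ¬ (ρ i ≡ j)
  least-step {i} least-i least-j ≡.refl = ρ-free i (Fin.≤-antisym
    (≡.subst (ρ i Fin.≤_) (ρ³≡id i) (proj₂ least-j)) (proj₁ least-i))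

  least-step² : ∀ {i j} → Least i → Least j → ¬ (ρ (ρ i) ≡ j)
  least-step² {i} least-i least-j eq = least-step least-j least-i
    (≡.trans (≡.cong ρ (≡.sym eq)) (ρ³≡id i))

  power-injective : ∀ {i j} → Least i → Least j → ∀ k l →
    power-ρ k i ≡ power-ρ l j → i ≡ j × k ≡ l
  power-injective Li Lj zero             zero             eq = eq , ≡.refl
  power-injective Li Lj zero             (suc zero)       eq = contradiction (≡.sym eq) (least-step Lj Li)
  power-injective Li Lj zero             (suc (suc zero)) eq = contradiction (≡.sym eq) (least-step² Lj Li)
  power-injective Li Lj (suc zero)       zero             eq = contradiction eq (least-step Li Lj)
  power-injective Li Lj (suc zero)       (suc zero)       eq = ρ-injective eq , ≡.refl
  power-injective Li Lj (suc zero)       (suc (suc zero)) eq = contradiction (ρ-injective (≡.sym eq)) (least-step Lj Li)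
  power-injective Li Lj (suc (suc zero)) zero             eq = contradiction eq (least-step² Li Lj)
  power-injective Li Lj (suc (suc zero)) (suc zero)       eq = contradiction (ρ-injective eq) (least-step Li Lj)
  power-injective Li Lj (suc (suc zero)) (suc (suc zero)) eq = ρ-injective (ρ-injective eq) , ≡.refl

  covered : ∀ i → ∃ λ j → ∃ λ k → power-ρ k (element j) ≡ i
  covered i with Fin.≤-total i (ρ i) | Fin.≤-total i (ρ (ρ i)) | Fin.≤-total (ρ i) (ρ (ρ i))
  ... | inj₁ i≤ρi | inj₁ i≤ρ²i | _ =
    let j , eq = complete (i≤ρi , i≤ρ²i) in j , zero , eq
  -- Here `ρ i` is least, and two more steps lead from it back to `i`.
  ... | inj₂ ρi≤i | _ | inj₁ ρi≤ρ²i =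
    let j , eq = complete (ρi≤ρ²i , ≡.subst (ρ i Fin.≤_) (≡.sym (ρ³≡id i)) ρi≤i)
    in j , suc (suc zero) , ≡.trans (≡.cong (λ k → ρ (ρ k)) eq) (ρ³≡id i)
  ... | inj₁ i≤ρi | inj₂ ρ²i≤i | _ = at-ρ² ρ²i≤i (Fin.≤-trans ρ²i≤i i≤ρi)
    where
    at-ρ² : ρ (ρ i) Fin.≤ i → ρ (ρ i) Fin.≤ ρ i → _
    at-ρ² p q =
      let j , eq = complete ( ≡.subst (ρ (ρ i) Fin.≤_) (≡.sym (ρ³≡id i)) p
                            , ≡.subst (ρ (ρ i) Fin.≤_) (≡.cong ρ (≡.sym (ρ³≡id i))) q)
      in j , suc zero , ≡.trans (≡.cong ρ eq) (ρ³≡id i)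
  ... | inj₂ ρi≤i | _ | inj₂ ρ²i≤ρi =
      let j , eq = complete ( ≡.subst (ρ (ρ i) Fin.≤_) (≡.sym (ρ³≡id i)) (Fin.≤-trans ρ²i≤ρi ρi≤i)
                            , ≡.subst (ρ (ρ i) Fin.≤_) (≡.cong ρ (≡.sym (ρ³≡id i))) ρ²i≤ρi)
      in j , suc zero , ≡.trans (≡.cong ρ eq) (ρ³≡id i)

  3∣ : 3 ∣ m
  3∣ = divides size (ℕ.≤-antisym
    (≡.subst (m ℕ.≤_) (ℕ.+-identityʳ _)
      (surjection⇒≤-*+ (λ j k → power-ρ k (element j)) (λ ()) (λ i → inj₁ (covered i))))
    (injection⇒*-≤ (λ j k → power-ρ k (element j)) λ {j} {k} {j′} {k′} eq →
      Product.map₁ injective (power-injective (satisfies j) (satisfies j′) k k′ eq)))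

-- A graph in place of a function lets a map on field elements be given by polynomial equations,
-- without inverses; the third condition on `R` says that the cube of the map is the identity.
cyclicRelation⇒3∣ : ∀ {m} (R : Rel (Fin m) ℓ) → (∀ i → ∃ (R i)) →
  (∀ {i j j′} → R i j → R i j′ → j ≡ j′) → (∀ {i j k} → R i j → R j k → R k i) →
  (∀ {i} → ¬ R i i) → 3 ∣ m
cyclicRelation⇒3∣ R total functional cyclic irrefl = FreeOrder3.3∣ (λ i → proj₁ (total i))
  (λ i → functional (step _) (cyclic (step i) (step _)))
  (λ i eq → irrefl (≡.subst (R i) eq (step i)))
  where
  step : ∀ i → R i (proj₁ (total i))
  step i = proj₂ (total i)

-- Polynomial identities with integer coefficients in a commutative ring.

module IntegerCoefficients (R : CommutativeRing c ℓ₁) where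

  open CommutativeRing R
  open RingProperties ring using (-‿distribˡ-*; -‿distribʳ-*; -‿involutive; -0#≈0#)
  open AbelianGroupProperties +-abelianGroup using (⁻¹-∙-comm)
  open Multiples +-monoid using (1+×) renaming (_×_ to _×′_; ×-homo-+ to ×′-homo-+)
  open SemiringMultiples semiring using (×1-homo-*)
  open SetoidReasoning setoid

  ⟦_⟧ᶻ : ℤ → Carrier
  ⟦ + n ⟧ᶻ      = n ×′ 1#
  ⟦ -[1+ n ] ⟧ᶻ = - (suc n ×′ 1#)

  ⊖-homo : ∀ m n → ⟦ m ⊖ n ⟧ᶻ ≈ m ×′ 1# - n ×′ 1#
  ⊖-homo m       zero    = sym (trans (+-congˡ -0#≈0#) (+-identityʳ _))
  ⊖-homo zero    (suc n) = sym (+-identityˡ _)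
  ⊖-homo (suc m) (suc n) = begin
    ⟦ suc m ⊖ suc n ⟧ᶻ                    ≡⟨ ≡.cong ⟦_⟧ᶻ (ℤ.[1+m]⊖[1+n]≡m⊖n m n) ⟩
    ⟦ m ⊖ n ⟧ᶻ                            ≈⟨ ⊖-homo m n ⟩
    m ×′ 1# - n ×′ 1#                     ≈⟨ +-congʳ (sym 1+x-1≈x) ⟩
    (1# + m ×′ 1# - 1#) - n ×′ 1#         ≈⟨ +-assoc _ _ _ ⟩
    1# + m ×′ 1# + (- 1# - n ×′ 1#)       ≈⟨ +-cong (sym (1+× m 1#)) (trans (⁻¹-∙-comm _ _) (-‿cong (sym (1+× n 1#)))) ⟩
    suc m ×′ 1# - suc n ×′ 1#             ∎
    where
    1+x-1≈x : ∀ {x} → 1# + x - 1# ≈ x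
    1+x-1≈x = trans (+-congʳ (+-comm _ _)) (trans (+-assoc _ _ _) (trans (+-congˡ (-‿inverseʳ 1#)) (+-identityʳ _)))

  -‿homo : ∀ i → ⟦ ℤ.- i ⟧ᶻ ≈ - ⟦ i ⟧ᶻ
  -‿homo (+ zero)   = sym -0#≈0#
  -‿homo +[1+ n ]   = refl
  -‿homo (-[1+ n ]) = sym (-‿involutive _)

  +-homo : ∀ i j → ⟦ i ℤ.+ j ⟧ᶻ ≈ ⟦ i ⟧ᶻ + ⟦ j ⟧ᶻ
  +-homo (+ m)      (+ n)      = ×′-homo-+ 1# m n
  +-homo (+ m)      (-[1+ n ]) = ⊖-homo m (suc n)
  +-homo (-[1+ m ]) (+ n)      = trans (⊖-homo n (suc m)) (+-comm _ _)
  +-homo (-[1+ m ]) (-[1+ n ]) = begin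
    - (suc (suc (m ℕ.+ n)) ×′ 1#)          ≡⟨ ≡.cong (λ k → - (k ×′ 1#)) (≡.sym (≡.cong suc (ℕ.+-suc m n))) ⟩
    - ((suc m ℕ.+ suc n) ×′ 1#)            ≈⟨ -‿cong (×′-homo-+ 1# (suc m) (suc n)) ⟩
    - (suc m ×′ 1# + suc n ×′ 1#)          ≈⟨ sym (⁻¹-∙-comm _ _) ⟩
    - (suc m ×′ 1#) - suc n ×′ 1#          ∎

  +*-homo : ∀ m j → ⟦ + m ℤ.* j ⟧ᶻ ≈ m ×′ 1# * ⟦ j ⟧ᶻ
  +*-homo m (+ n)      = trans (reflexive (≡.cong ⟦_⟧ᶻ (≡.sym (ℤ.pos-* m n)))) (×1-homo-* m n)
  +*-homo m (-[1+ n ]) = begin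
    ⟦ + m ℤ.* -[1+ n ] ⟧ᶻ           ≡⟨ ≡.cong ⟦_⟧ᶻ (≡.sym (ℤ.neg-distribʳ-* (+ m) +[1+ n ])) ⟩
    ⟦ ℤ.- (+ m ℤ.* +[1+ n ]) ⟧ᶻ     ≈⟨ -‿homo (+ m ℤ.* +[1+ n ]) ⟩
    - ⟦ + m ℤ.* +[1+ n ] ⟧ᶻ         ≈⟨ -‿cong (+*-homo m (+[1+ n ])) ⟩
    - (m ×′ 1# * suc n ×′ 1#)       ≈⟨ -‿distribʳ-* _ _ ⟩
    m ×′ 1# * - (suc n ×′ 1#)       ∎

  *-homo : ∀ i j → ⟦ i ℤ.* j ⟧ᶻ ≈ ⟦ i ⟧ᶻ * ⟦ j ⟧ᶻ
  *-homo (+ m)      j = +*-homo m j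
  *-homo (-[1+ m ]) j = begin
    ⟦ -[1+ m ] ℤ.* j ⟧ᶻ         ≡⟨ ≡.cong ⟦_⟧ᶻ (≡.sym (ℤ.neg-distribˡ-* +[1+ m ] j)) ⟩
    ⟦ ℤ.- (+[1+ m ] ℤ.* j) ⟧ᶻ   ≈⟨ -‿homo (+[1+ m ] ℤ.* j) ⟩
    - ⟦ +[1+ m ] ℤ.* j ⟧ᶻ       ≈⟨ -‿cong (+*-homo (suc m) j) ⟩
    - (suc m ×′ 1# * ⟦ j ⟧ᶻ)    ≈⟨ -‿distribˡ-* _ _ ⟩
    - (suc m ×′ 1#) * ⟦ j ⟧ᶻ    ∎

  morphism : ℤ.+-*-rawRing -Raw-AlmostCommutative⟶ fromCommutativeRing R
  morphism = record
    { ⟦_⟧    = ⟦_⟧ᶻ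
    ; +-homo = +-homo
    ; *-homo = *-homo
    ; -‿homo = -‿homo
    ; 0-homo = refl
    ; 1-homo = refl
    }

  -- Coefficients are compared as integers and not by their images, so whatever the solver accepts
  -- holds in every characteristic.
  _coeff≟_ : ∀ i j → Maybe (⟦ i ⟧ᶻ ≈ ⟦ j ⟧ᶻ)
  i coeff≟ j = Maybe.map (λ i≡j → reflexive (≡.cong ⟦_⟧ᶻ i≡j)) (dec⇒maybe (i ℤ.≟ j))

  module Solver = RingSolver ℤ.+-*-rawRing (fromCommutativeRing R) morphism _coeff≟_
  open Solver public using (Polynomial; con; var; _:+_; _:*_; _:-_; :-_; _:^_; _:×_; _:=_)
  open Solver using (⟦_⟧; ⟦_⟧↓; ⟦_⟧N-cong; correct; prove; normalise; _≟N_; op; [+]; [*])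
  open import Relation.Binary.Reflection setoid var ⟦_⟧ ⟦_⟧↓ correct using (close)
  open import Algebra.Properties.Semiring.Exp semiring using (^-congˡ)

  -- Comparing normal forms syntactically is much cheaper than the comparison
  -- of their denotations that the solver of the library asks for.
  solve : ∀ n (f : N-ary n (Polynomial n) (Polynomial n × Polynomial n)) →
    let l , r = close n f in
    {T (is-just (normalise l ≟N normalise r))} →
    Eq n _≈_ (curryⁿ ⟦ l ⟧) (curryⁿ ⟦ r ⟧)
  solve n f {p} with close n f
  ... | l , r with normalise l ≟N normalise r
  ...   | just eq = curryⁿ-cong _≈_ ⟦ l ⟧ ⟦ r ⟧ λ ρ → prove ρ l r (⟦ eq ⟧N-cong ρ)

  ⟦⟧-cong : ∀ {n} (e : Polynomial n) {ρ σ} → Pointwise _≈_ ρ σ → ⟦ e ⟧ ρ ≈ ⟦ e ⟧ σ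
  ⟦⟧-cong (op [+] e e′) ρ≈σ = +-cong (⟦⟧-cong e ρ≈σ) (⟦⟧-cong e′ ρ≈σ)
  ⟦⟧-cong (op [*] e e′) ρ≈σ = *-cong (⟦⟧-cong e ρ≈σ) (⟦⟧-cong e′ ρ≈σ)
  ⟦⟧-cong (con i)       ρ≈σ = refl
  ⟦⟧-cong (var i)       ρ≈σ = Pointwise.lookup ρ≈σ i
  ⟦⟧-cong (e :^ k)      ρ≈σ = ^-congˡ k (⟦⟧-cong e ρ≈σ)
  ⟦⟧-cong (:- e)        ρ≈σ = -‿cong (⟦⟧-cong e ρ≈σ)

  -- Exhibiting an expression as the denotation of a polynomial replaces a nest of `+-cong` and
  -- `*-cong`.
  congruence : ∀ n (f : N-ary n (Polynomial n) (Polynomial n)) {ρ σ} →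
    Pointwise _≈_ ρ σ → ⟦ f $ⁿ Vec.map var (Vec.allFin n) ⟧ ρ ≈ ⟦ f $ⁿ Vec.map var (Vec.allFin n) ⟧ σ
  congruence n f = ⟦⟧-cong (f $ⁿ Vec.map var (Vec.allFin n))

-- Arithmetic in a finite field.

module FieldProperties (F : FiniteField c ℓ₁ ℓ₂) where

  open FiniteField F hiding (zero)

  commutativeRing : CommutativeRing _ _
  commutativeRing = HeytingCommutativeRing.commutativeRing heytingCommutativeRing

  open CommutativeRing commutativeRing using (semiring; ring)
  open RawSemiringDefinitions (Semiring.rawSemiring semiring) public using (_^_) renaming (_×_ to _·_)
  open IntegerCoefficients commutativeRing public using
    (Polynomial; con; _:+_; _:*_; _:-_; :-_; _:^_; _:×_; _:=_; solve; congruence)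
  open RingProperties ring using (x≈y⇒x∙y⁻¹≈ε; x∙y⁻¹≈ε⇒x≈y)
  open SetoidReasoning setoid

  -- Ideal membership as a method of proof: the cofactor `k` of the hypothesis `l ≈ r` is a
  -- certificate, and what remains is a polynomial identity for `solve`. The longer versions take
  -- more generators.
  modulo₁ : ∀ {a b k l r} → l ≈ r → a ≈ b + k * (l - r) → a ≈ b
  modulo₁ {a} {b} {k} {l} {r} l≈r eq = begin
    a                ≈⟨ eq ⟩
    b + k * (l - r)  ≈⟨ +-congˡ (*-congˡ (x≈y⇒x∙y⁻¹≈ε l≈r)) ⟩
    b + k * 0#       ≈⟨ +-congˡ (zeroʳ k) ⟩
    b + 0#           ≈⟨ +-identityʳ b ⟩
    b                ∎

  modulo₂ : ∀ {a b k l r k′ l′ r′} → l ≈ r → l′ ≈ r′ →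
    a ≈ b + k * (l - r) + k′ * (l′ - r′) → a ≈ b
  modulo₂ l≈r l′≈r′ eq = modulo₁ l≈r (modulo₁ l′≈r′ eq)

  modulo₃ : ∀ {a b k l r k′ l′ r′ k″ l″ r″} → l ≈ r → l′ ≈ r′ → l″ ≈ r″ →
    a ≈ b + k * (l - r) + k′ * (l′ - r′) + k″ * (l″ - r″) → a ≈ b
  modulo₃ l≈r l′≈r′ l″≈r″ eq = modulo₂ l≈r l′≈r′ (modulo₁ l″≈r″ eq)

  modulo₄ : ∀ {a b k l r k′ l′ r′ k″ l″ r″ k‴ l‴ r‴} → l ≈ r → l′ ≈ r′ → l″ ≈ r″ → l‴ ≈ r‴ →
    a ≈ b + k * (l - r) + k′ * (l′ - r′) + k″ * (l″ - r″) + k‴ * (l‴ - r‴) → a ≈ b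
  modulo₄ l≈r l′≈r′ l″≈r″ l‴≈r‴ eq = modulo₃ l≈r l′≈r′ l″≈r″ (modulo₁ l‴≈r‴ eq)

  from : Fin order → Carrier
  from = Inverse.from enumeration

  to : Carrier → Fin order
  to = Inverse.to enumeration

  from-to : ∀ x → from (to x) ≈ x
  from-to x = Inverse.inverseʳ enumeration ≡.refl

  from-injective : ∀ {i j} → from i ≈ from j → i ≡ j
  from-injective {i} {j} eq = ≡.trans (≡.sym (Inverse.inverseˡ enumeration refl))
    (≡.trans (Inverse.to-cong enumeration eq) (Inverse.inverseˡ enumeration refl))

  any? : {P : Pred Carrier p} → (∀ x → Dec (P x)) → (∀ {x y} → x ≈ y → P x → P y) → Dec (∃ P)
  any? P? P-resp = map′ (λ (i , Pi) → from i , Pi) (λ (x , Px) → to x , P-resp (sym (from-to x)) Px)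
    (Fin.any? (λ i → P? (from i)))

  -- In the zero ring `0# - 0#` would be invertible, and `0#` apart from itself.
  1≉0 : ¬ (1# ≈ 0#)
  1≉0 1≈0 = #-irrefl refl (invertible⇒# {0#} {0#} (0# , eq , eq))
    where
    eq : ∀ {x} → x ≈ 1#
    eq {x} = trans (sym (*-identityʳ x)) (trans (*-congˡ 1≈0) (trans (zeroʳ x) (sym 1≈0)))

  -- If the search behind `⁻¹` fails, `x` is not apart from `0#`, since apartness supplies an
  -- inverse of `x - 0#`; by tightness `x` is then zero.
  *-inverseʳ : ∀ {x} → ¬ (x ≈ 0#) → x * x ⁻¹ ≈ 1#
  *-inverseʳ {x} x≉0 with Fin.any? (λ i → x * from i ≟ 1#)
  ... | yes (_ , eq) = eq
  ... | no ∄ = contradiction (proj₁ (tight x 0#) λ x#0 →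
      let y , _ , x-0*y≈1 = #⇒invertible x#0 in
      ∄ (to y , trans (*-congˡ (from-to y)) (trans (*-congʳ (x≈x-0 x)) x-0*y≈1)))
    x≉0
    where
    x≈x-0 : ∀ x → x ≈ x - 0#
    x≈x-0 = solve 1 λ x → x := x :- con (+ 0)

  zero-product : ∀ {x y} → x * y ≈ 0# → x ≈ 0# ⊎ y ≈ 0#
  zero-product {x} {y} xy≈0 with x ≟ 0#
  ... | yes x≈0 = inj₁ x≈0
  ... | no  x≉0 = inj₂ (modulo₂ (*-inverseʳ x≉0) xy≈0
    (solve 3 (λ x y v → y := con (+ 0) :+ (:- y) :* (x :* v :- con (+ 1)) :+ v :* (x :* y :- con (+ 0))) x y (x ⁻¹)))

  ≉0-* : ∀ {x y} → ¬ (x ≈ 0#) → ¬ (y ≈ 0#) → ¬ (x * y ≈ 0#)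
  ≉0-* x≉0 y≉0 xy≈0 = Sum.[ x≉0 , y≉0 ]′ (zero-product xy≈0)

  cancel : ∀ {a x} → ¬ (a ≈ 0#) → a * x ≈ 0# → x ≈ 0#
  cancel a≉0 eq = Sum.[ (λ a≈0 → contradiction a≈0 a≉0) , (λ x≈0 → x≈0) ]′ (zero-product eq)

  cancel-difference : ∀ {a x y} → ¬ (a ≈ 0#) → a * (x - y) ≈ 0# → x ≈ y
  cancel-difference {x = x} {y} a≉0 eq = x∙y⁻¹≈ε⇒x≈y x y (cancel a≉0 eq)

  square-zero : ∀ {x} → x ^ 2 ≈ 0# → x ≈ 0#
  square-zero {x} eq = Sum.[ (λ x≈0 → x≈0) , (λ x≈0 → x≈0) ]′
    (zero-product (trans (*-congˡ (sym (*-identityʳ x))) eq))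

-- Changes of variables in Weierstrass equations, and the invariants c₄ and Δ.

module Isomorphisms (F : FiniteField c ℓ₁ ℓ₂) where

  open FiniteField F hiding (zero)
  open FieldProperties F
  open EllipticCurves F
  open WeierstrassEquation

  coefficients : WeierstrassEquation → Vec Carrier 5
  coefficients W = a₁ W ∷ a₂ W ∷ a₃ W ∷ a₄ W ∷ a₆ W ∷ []

  infix 4 _≈ʷ_
  _≈ʷ_ : Rel WeierstrassEquation _
  W ≈ʷ W′ = Pointwise _≈_ (coefficients W) (coefficients W′)

  ≈ʷ-sym : ∀ {W W′} → W ≈ʷ W′ → W′ ≈ʷ W
  ≈ʷ-sym = Pointwise.sym sym

  ≈ʷ-trans : ∀ {W W′ W″} → W ≈ʷ W′ → W′ ≈ʷ W″ → W ≈ʷ W″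
  ≈ʷ-trans = Pointwise.trans trans

  -- The substitution is split into a diagonal part and a unipotent part, `transform`. An
  -- isomorphism is an equation between a scaled target and a transformed source, with no division
  -- by powers of u.
  scale : Carrier → WeierstrassEquation → WeierstrassEquation
  scale u W = record
    { a₁ = u * a₁ W
    ; a₂ = u ^ 2 * a₂ W
    ; a₃ = u ^ 3 * a₃ W
    ; a₄ = u ^ 4 * a₄ W
    ; a₆ = u ^ 6 * a₆ W
    }

  transform : (r s t : Carrier) → WeierstrassEquation → WeierstrassEquation
  transform r s t W = record
    { a₁ = a₁ W + 2 · s
    ; a₂ = a₂ W - s * a₁ W + 3 · r - s ^ 2
    ; a₃ = a₃ W + r * a₁ W + 2 · t
    ; a₄ = a₄ W - s * a₃ W + 2 · (r * a₂ W) - (t + r * s) * a₁ W + 3 · r ^ 2 - 2 · (s * t)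
    ; a₆ = a₆ W + r * a₄ W + r ^ 2 * a₂ W + r ^ 3 - t * a₃ W - t ^ 2 - r * t * a₁ W
    }

  private
    scaleᵖ : ∀ {n} → Polynomial n → Vec (Polynomial n) 5 → Vec (Polynomial n) 5
    scaleᵖ u (a₁ ∷ a₂ ∷ a₃ ∷ a₄ ∷ a₆ ∷ []) =
      u :* a₁ ∷ u :^ 2 :* a₂ ∷ u :^ 3 :* a₃ ∷ u :^ 4 :* a₄ ∷ u :^ 6 :* a₆ ∷ []

    transformᵖ : ∀ {n} → (r s t : Polynomial n) → Vec (Polynomial n) 5 → Vec (Polynomial n) 5
    transformᵖ r s t (a₁ ∷ a₂ ∷ a₃ ∷ a₄ ∷ a₆ ∷ []) =
      a₁ :+ 2 :× s ∷
      a₂ :- s :* a₁ :+ 3 :× r :- s :^ 2 ∷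
      a₃ :+ r :* a₁ :+ 2 :× t ∷
      a₄ :- s :* a₃ :+ 2 :× (r :* a₂) :- (t :+ r :* s) :* a₁ :+ 3 :× r :^ 2 :- 2 :× (s :* t) ∷
      a₆ :+ r :* a₄ :+ r :^ 2 :* a₂ :+ r :^ 3 :- t :* a₃ :- t :^ 2 :- r :* t :* a₁ ∷ []

    c₄ᵖ Δᵖ : ∀ {n} → Vec (Polynomial n) 5 → Polynomial n
    c₄ᵖ (a₁ ∷ a₂ ∷ a₃ ∷ a₄ ∷ a₆ ∷ []) =
      (a₁ :^ 2 :+ 4 :× a₂) :^ 2 :- 24 :× (2 :× a₄ :+ a₁ :* a₃)
    Δᵖ (a₁ ∷ a₂ ∷ a₃ ∷ a₄ ∷ a₆ ∷ []) =
      :- (B₂ :^ 2 :* B₈) :- 8 :× B₄ :^ 3 :- 27 :× B₆ :^ 2 :+ 9 :× (B₂ :* B₄ :* B₆)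
      where
      B₂ = a₁ :^ 2 :+ 4 :× a₂
      B₄ = 2 :× a₄ :+ a₁ :* a₃
      B₆ = a₃ :^ 2 :+ 4 :× a₆
      B₈ = a₁ :^ 2 :* a₆ :+ 4 :× (a₂ :* a₆) :- a₁ :* a₃ :* a₄ :+ a₂ :* a₃ :^ 2 :- a₄ :^ 2

  -- The invariant of weight 4 in j = c₄³/Δ. Its law and that of Δ are kept apart, which avoids the
  -- quotient.
  c₄ : WeierstrassEquation → Carrier
  c₄ W = b₂ W ^ 2 - 24 · b₄ W

  c₄-cong : ∀ {W W′} → W ≈ʷ W′ → c₄ W ≈ c₄ W′
  c₄-cong = congruence 5 λ a₁ a₂ a₃ a₄ a₆ → c₄ᵖ (a₁ ∷ a₂ ∷ a₃ ∷ a₄ ∷ a₆ ∷ [])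

  Δ-cong : ∀ {W W′} → W ≈ʷ W′ → Δ W ≈ Δ W′
  Δ-cong = congruence 5 λ a₁ a₂ a₃ a₄ a₆ → Δᵖ (a₁ ∷ a₂ ∷ a₃ ∷ a₄ ∷ a₆ ∷ [])

  scale-cong : ∀ u {W W′} → W ≈ʷ W′ → scale u W ≈ʷ scale u W′
  scale-cong u (e₁ ∷ e₂ ∷ e₃ ∷ e₄ ∷ e₆ ∷ []) =
    *-congˡ e₁ ∷ *-congˡ e₂ ∷ *-congˡ e₃ ∷ *-congˡ e₄ ∷ *-congˡ e₆ ∷ []

  transform-cong : ∀ r s t {W W′} → W ≈ʷ W′ → transform r s t W ≈ʷ transform r s t W′
  transform-cong r s t W≈W′ =
    coordinate zero ∷ coordinate (suc zero) ∷ coordinate (suc (suc zero)) ∷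
    coordinate (suc (suc (suc zero))) ∷ coordinate (suc (suc (suc (suc zero)))) ∷ []
    where
    coordinate = λ i → congruence 8 (λ r s t a₁ a₂ a₃ a₄ a₆ →
      Vec.lookup (transformᵖ r s t (a₁ ∷ a₂ ∷ a₃ ∷ a₄ ∷ a₆ ∷ [])) i)
      (refl {r} ∷ refl {s} ∷ refl {t} ∷ W≈W′)

  scale-scale : ∀ u v W → scale (u * v) W ≈ʷ scale u (scale v W)
  scale-scale u v W =
    solve 3 (λ u v a → u :* v :* a := u :* (v :* a)) u v (a₁ W) ∷
    solve 3 (λ u v a → (u :* v) :^ 2 :* a := u :^ 2 :* (v :^ 2 :* a)) u v (a₂ W) ∷
    solve 3 (λ u v a → (u :* v) :^ 3 :* a := u :^ 3 :* (v :^ 3 :* a)) u v (a₃ W) ∷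
    solve 3 (λ u v a → (u :* v) :^ 4 :* a := u :^ 4 :* (v :^ 4 :* a)) u v (a₄ W) ∷
    solve 3 (λ u v a → (u :* v) :^ 6 :* a := u :^ 6 :* (v :^ 6 :* a)) u v (a₆ W) ∷ []

  scale-one : ∀ {u} W → u ≈ 1# → scale u W ≈ʷ W
  scale-one {u} W u≈1 =
    modulo₁ u≈1 (solve 2 (λ u a → u :* a := a :+ a :* (u :- con (+ 1))) u (a₁ W)) ∷
    modulo₁ u≈1 (solve 2 (λ u a → u :^ 2 :* a := a :+ a :* (u :+ con (+ 1)) :* (u :- con (+ 1))) u (a₂ W)) ∷
    modulo₁ u≈1 (solve 2 (λ u a → u :^ 3 :* a := a :+ a :* (u :^ 2 :+ u :+ con (+ 1)) :* (u :- con (+ 1))) u (a₃ W)) ∷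
    modulo₁ u≈1 (solve 2 (λ u a → u :^ 4 :* a :=
      a :+ a :* (u :^ 3 :+ u :^ 2 :+ u :+ con (+ 1)) :* (u :- con (+ 1))) u (a₄ W)) ∷
    modulo₁ u≈1 (solve 2 (λ u a → u :^ 6 :* a :=
      a :+ a :* (u :^ 5 :+ u :^ 4 :+ u :^ 3 :+ u :^ 2 :+ u :+ con (+ 1)) :* (u :- con (+ 1))) u (a₆ W)) ∷ []

  -- Scalings normalise the unipotent substitutions, `r`, `s`, `t` having the weights 2, 1, 3. This
  -- brings inverses and composites of isomorphisms back to the required form.
  transform-scale : ∀ u r s t W →
    transform (u ^ 2 * r) (u * s) (u ^ 3 * t) (scale u W) ≈ʷ scale u (transform r s t W)
  transform-scale u r s t W =
    solve 9 (coordinate zero) u r s t (a₁ W) (a₂ W) (a₃ W) (a₄ W) (a₆ W) ∷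
    solve 9 (coordinate (suc zero)) u r s t (a₁ W) (a₂ W) (a₃ W) (a₄ W) (a₆ W) ∷
    solve 9 (coordinate (suc (suc zero))) u r s t (a₁ W) (a₂ W) (a₃ W) (a₄ W) (a₆ W) ∷
    solve 9 (coordinate (suc (suc (suc zero)))) u r s t (a₁ W) (a₂ W) (a₃ W) (a₄ W) (a₆ W) ∷
    solve 9 (coordinate (suc (suc (suc (suc zero))))) u r s t (a₁ W) (a₂ W) (a₃ W) (a₄ W) (a₆ W) ∷ []
    where
    coordinate : Fin 5 → N-ary 9 (Polynomial 9) (Polynomial 9 × Polynomial 9)
    coordinate i u r s t a₁ a₂ a₃ a₄ a₆ = let a = a₁ ∷ a₂ ∷ a₃ ∷ a₄ ∷ a₆ ∷ [] in
      Vec.lookup (transformᵖ (u :^ 2 :* r) (u :* s) (u :^ 3 :* t) (scaleᵖ u a)) i :=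
      Vec.lookup (scaleᵖ u (transformᵖ r s t a)) i

  -- The term `s * r′` arises when x′ = x″ + r′ is put into y = y′ + sx′ + t.
  transform-transform : ∀ r s t r′ s′ t′ W →
    transform r′ s′ t′ (transform r s t W) ≈ʷ transform (r + r′) (s + s′) (t + t′ + s * r′) W
  transform-transform r s t r′ s′ t′ W =
    solve 11 (coordinate zero) r s t r′ s′ t′ (a₁ W) (a₂ W) (a₃ W) (a₄ W) (a₆ W) ∷
    solve 11 (coordinate (suc zero)) r s t r′ s′ t′ (a₁ W) (a₂ W) (a₃ W) (a₄ W) (a₆ W) ∷
    solve 11 (coordinate (suc (suc zero))) r s t r′ s′ t′ (a₁ W) (a₂ W) (a₃ W) (a₄ W) (a₆ W) ∷
    solve 11 (coordinate (suc (suc (suc zero)))) r s t r′ s′ t′ (a₁ W) (a₂ W) (a₃ W) (a₄ W) (a₆ W) ∷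
    solve 11 (coordinate (suc (suc (suc (suc zero))))) r s t r′ s′ t′ (a₁ W) (a₂ W) (a₃ W) (a₄ W) (a₆ W) ∷ []
    where
    coordinate : Fin 5 → N-ary 11 (Polynomial 11) (Polynomial 11 × Polynomial 11)
    coordinate i r s t r′ s′ t′ a₁ a₂ a₃ a₄ a₆ = let a = a₁ ∷ a₂ ∷ a₃ ∷ a₄ ∷ a₆ ∷ [] in
      Vec.lookup (transformᵖ r′ s′ t′ (transformᵖ r s t a)) i :=
      Vec.lookup (transformᵖ (r :+ r′) (s :+ s′) (t :+ t′ :+ s :* r′) a) i

  transform-inverse : ∀ r s t W → transform (- r) (- s) (r * s - t) (transform r s t W) ≈ʷ W
  transform-inverse r s t W =
    solve 8 (coordinate zero) r s t (a₁ W) (a₂ W) (a₃ W) (a₄ W) (a₆ W) ∷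
    solve 8 (coordinate (suc zero)) r s t (a₁ W) (a₂ W) (a₃ W) (a₄ W) (a₆ W) ∷
    solve 8 (coordinate (suc (suc zero))) r s t (a₁ W) (a₂ W) (a₃ W) (a₄ W) (a₆ W) ∷
    solve 8 (coordinate (suc (suc (suc zero)))) r s t (a₁ W) (a₂ W) (a₃ W) (a₄ W) (a₆ W) ∷
    solve 8 (coordinate (suc (suc (suc (suc zero))))) r s t (a₁ W) (a₂ W) (a₃ W) (a₄ W) (a₆ W) ∷ []
    where
    coordinate : Fin 5 → N-ary 8 (Polynomial 8) (Polynomial 8 × Polynomial 8)
    coordinate i r s t a₁ a₂ a₃ a₄ a₆ = let a = a₁ ∷ a₂ ∷ a₃ ∷ a₄ ∷ a₆ ∷ [] in
      Vec.lookup (transformᵖ (:- r) (:- s) (r :* s :- t) (transformᵖ r s t a)) i := Vec.lookup a i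

  c₄-scale : ∀ u W → c₄ (scale u W) ≈ u ^ 4 * c₄ W
  c₄-scale u W = solve 6 (λ u a₁ a₂ a₃ a₄ a₆ → let a = a₁ ∷ a₂ ∷ a₃ ∷ a₄ ∷ a₆ ∷ [] in
    c₄ᵖ (scaleᵖ u a) := u :^ 4 :* c₄ᵖ a) u (a₁ W) (a₂ W) (a₃ W) (a₄ W) (a₆ W)

  Δ-scale : ∀ u W → Δ (scale u W) ≈ u ^ 12 * Δ W
  Δ-scale u W = solve 6 (λ u a₁ a₂ a₃ a₄ a₆ → let a = a₁ ∷ a₂ ∷ a₃ ∷ a₄ ∷ a₆ ∷ [] in
    Δᵖ (scaleᵖ u a) := u :^ 12 :* Δᵖ a) u (a₁ W) (a₂ W) (a₃ W) (a₄ W) (a₆ W)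

  c₄-transform : ∀ r s t W → c₄ (transform r s t W) ≈ c₄ W
  c₄-transform r s t W = solve 8 (λ r s t a₁ a₂ a₃ a₄ a₆ → let a = a₁ ∷ a₂ ∷ a₃ ∷ a₄ ∷ a₆ ∷ [] in
    c₄ᵖ (transformᵖ r s t a) := c₄ᵖ a) r s t (a₁ W) (a₂ W) (a₃ W) (a₄ W) (a₆ W)

  Δ-transform : ∀ r s t W → Δ (transform r s t W) ≈ Δ W
  Δ-transform r s t W = solve 8 (λ r s t a₁ a₂ a₃ a₄ a₆ → let a = a₁ ∷ a₂ ∷ a₃ ∷ a₄ ∷ a₆ ∷ [] in
    Δᵖ (transformᵖ r s t a) := Δᵖ a) r s t (a₁ W) (a₂ W) (a₃ W) (a₄ W) (a₆ W)

-- Symmetry and transitivity of isomorphism, and its effect on c₄ and Δ.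

module IsomorphismRelation (F : FiniteField c ℓ₁ ℓ₂) where

  open FiniteField F hiding (zero)
  open FieldProperties F
  open EllipticCurves F
  open Isomorphisms F
  open EllipticCurve using (equation)
  open WeierstrassEquation using (Δ)

  ≅⇒≈ʷ : ∀ {E E′} (φ : E ≅ E′) → let open _≅_ φ in
    scale u (equation E′) ≈ʷ transform r s t (equation E)
  ≅⇒≈ʷ φ = eq₁ ∷ eq₂ ∷ eq₃ ∷ eq₄ ∷ eq₆ ∷ []
    where open _≅_ φ

  ≈ʷ⇒≅ : ∀ {E E′} u r s t → ¬ (u ≈ 0#) →
    scale u (equation E′) ≈ʷ transform r s t (equation E) → E ≅ E′
  ≈ʷ⇒≅ u r s t u≉0 (eq₁ ∷ eq₂ ∷ eq₃ ∷ eq₄ ∷ eq₆ ∷ []) = record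
    { u = u ; r = r ; s = s ; t = t ; u≉0 = u≉0
    ; eq₁ = eq₁ ; eq₂ = eq₂ ; eq₃ = eq₃ ; eq₄ = eq₄ ; eq₆ = eq₆
    }

  ≅-sym : ∀ {E E′} → E ≅ E′ → E′ ≅ E
  ≅-sym {E} {E′} φ = ≈ʷ⇒≅ v (v ^ 2 * - r) (v * - s) (v ^ 3 * (r * s - t)) v≉0
    (≈ʷ-trans (scale-cong v (≈ʷ-sym (transform-inverse r s t W)))
    (≈ʷ-trans (≈ʷ-sym (transform-scale v (- r) (- s) (r * s - t) (transform r s t W)))
    (transform-cong _ _ _
      (≈ʷ-trans (scale-cong v (≈ʷ-sym (≅⇒≈ʷ φ)))
      (≈ʷ-trans (≈ʷ-sym (scale-scale v u W′))
      (scale-one W′ (trans (*-comm v u) uv≈1)))))))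
    where
    open _≅_ φ
    W W′ : WeierstrassEquation
    W  = equation E
    W′ = equation E′
    v : Carrier
    v = u ⁻¹
    uv≈1 : u * v ≈ 1#
    uv≈1 = *-inverseʳ u≉0
    v≉0 : ¬ (v ≈ 0#)
    v≉0 v≈0 = 1≉0 (trans (sym uv≈1) (trans (*-congˡ v≈0) (zeroʳ u)))

  ≅-trans : ∀ {E E′ E″} → E ≅ E′ → E′ ≅ E″ → E ≅ E″
  ≅-trans {E} {E′} {E″} φ ψ =
    ≈ʷ⇒≅ (φ.u * ψ.u) _ _ _ (≉0-* φ.u≉0 ψ.u≉0)
    (≈ʷ-trans (scale-scale φ.u ψ.u (equation E″))
    (≈ʷ-trans (scale-cong φ.u (≅⇒≈ʷ ψ))
    (≈ʷ-trans (≈ʷ-sym (transform-scale φ.u ψ.r ψ.s ψ.t (equation E′)))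
    (≈ʷ-trans (transform-cong _ _ _ (≅⇒≈ʷ φ))
    (transform-transform φ.r φ.s φ.t _ _ _ (equation E))))))
    where
    module φ = _≅_ φ
    module ψ = _≅_ ψ

  c₄-law : ∀ {E E′} (φ : E ≅ E′) → _≅_.u φ ^ 4 * c₄ (equation E′) ≈ c₄ (equation E)
  c₄-law {E} {E′} φ = trans (sym (c₄-scale _ (equation E′)))
    (trans (c₄-cong (≅⇒≈ʷ φ)) (c₄-transform _ _ _ (equation E)))

  Δ-law : ∀ {E E′} (φ : E ≅ E′) → _≅_.u φ ^ 12 * Δ (equation E′) ≈ Δ (equation E)
  Δ-law {E} {E′} φ = trans (sym (Δ-scale _ (equation E′)))
    (trans (Δ-cong (≅⇒≈ʷ φ)) (Δ-transform _ _ _ (equation E)))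

-- A primitive cube root of unity from q ≡ 1 modulo 3.

-- All that the geometry uses of the congruence. Both conditions are polynomial equations, so they
-- can serve as generators in `modulo₁` and its variants; that ω differs from 1 follows from 3 being
-- invertible.
record PrimitiveCubeRoot (F : FiniteField c ℓ₁ ℓ₂) : Set (c ⊔ ℓ₁) where
  open FiniteField F
  open FieldProperties F
  field
    ⅓        : Carrier
    3*⅓≈1    : 3 · 1# * ⅓ ≈ 1#
    ω        : Carrier
    ω²+ω+1≈0 : ω ^ 2 + ω + 1# ≈ 0#

module OrderCongruence (F : FiniteField c ℓ₁ ℓ₂) (q%3≡1 : FiniteField.order F % 3 ≡ 1) where

  open FiniteField F hiding (zero)
  open FieldProperties F

  private
    3∤q : ¬ (3 ∣ order)
    3∤q 3∣q = contradiction (≡.trans (≡.sym q%3≡1) (n∣m⇒m%n≡0 order 3 3∣q)) λ ()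

    3∤1+q : ¬ (3 ∣ suc order)
    3∤1+q 3∣1+q = contradiction
      (≡.trans (≡.sym (≡.trans (ℕ.%-distribˡ-+ 1 order 3) (≡.cong (λ r → (1 ℕ.+ r) % 3) q%3≡1)))
        (n∣m⇒m%n≡0 (suc order) 3 3∣1+q))
      λ ()

  -- In characteristic 3 the translation x ↦ x + 1 would have order 3.
  3≉0 : ¬ (3 · 1# ≈ 0#)
  3≉0 3≈0 = 3∤q (cyclicRelation⇒3∣ (λ i j → from j ≈ from i + 1#)
    (λ i → to (from i + 1#) , from-to _)
    (λ eq eq′ → from-injective (trans eq (sym eq′)))
    (λ {i} {j} {k} eq eq′ → modulo₃ eq eq′ 3≈0
      (solve 3 (λ x y z → x := (z :+ con (+ 1)) :+ :- con (+ 1) :* (y :- (x :+ con (+ 1)))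
        :+ :- con (+ 1) :* (z :- (y :+ con (+ 1))) :+ :- con (+ 1) :* (3 :× con (+ 1) :- con (+ 0)))
        (from i) (from j) (from k)))
    (λ {i} eq → 1≉0 (modulo₁ eq
      (solve 1 (λ x → con (+ 1) := con (+ 0) :+ :- con (+ 1) :* (x :- (x :+ con (+ 1)))) (from i)))))

  -- The graph of x ↦ 1/(1 - x) on the projective line, whose point at infinity is zero.
  Step : Rel (Fin (suc order)) ℓ₁
  Step zero    zero    = 1# ≈ 0#
  Step zero    (suc j) = from j ≈ 0#
  Step (suc i) zero    = from i ≈ 1#
  Step (suc i) (suc j) = from j * (1# - from i) ≈ 1#

  Step-total : ∀ i → ∃ (Step i)
  Step-total zero    = suc (to 0#) , from-to 0#
  Step-total (suc i) with from i ≟ 1#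
  ... | yes x≈1 = zero , x≈1
  ... | no  x≉1 = suc (to ((1# - from i) ⁻¹)) ,
    trans (*-congʳ (from-to _)) (trans (*-comm _ _) (*-inverseʳ λ 1-x≈0 →
      x≉1 (modulo₁ 1-x≈0 (solve 1 (λ x → x := con (+ 1) :+ :- con (+ 1) :* (con (+ 1) :- x :- con (+ 0))) (from i)))))

  private
    no-inverse : ∀ {x y} → x ≈ 1# → ¬ (y * (1# - x) ≈ 1#)
    no-inverse {x} {y} x≈1 eq = 1≉0 (modulo₂ eq x≈1
      (solve 2 (λ x y → con (+ 1) := con (+ 0) :+ :- con (+ 1) :* (y :* (con (+ 1) :- x) :- con (+ 1))
        :+ (:- y) :* (x :- con (+ 1))) x y))

  Step-functional : ∀ {i j j′} → Step i j → Step i j′ → j ≡ j′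
  Step-functional {zero}  {zero}  {_}      1≈0 _    = contradiction 1≈0 1≉0
  Step-functional {zero}  {suc j} {zero}   _   1≈0  = contradiction 1≈0 1≉0
  Step-functional {zero}  {suc j} {suc j′} eq  eq′  = ≡.cong suc (from-injective (trans eq (sym eq′)))
  Step-functional {suc i} {zero}  {zero}   _   _    = ≡.refl
  Step-functional {suc i} {zero}  {suc j′} eq  eq′  = contradiction eq′ (no-inverse eq)
  Step-functional {suc i} {suc j} {zero}   eq  eq′  = contradiction eq (no-inverse eq′)
  Step-functional {suc i} {suc j} {suc j′} eq  eq′  = ≡.cong suc (from-injective (modulo₂ eq eq′
    (solve 3 (λ x y z → y := z :+ z :* (y :* (con (+ 1) :- x) :- con (+ 1))
      :+ (:- y) :* (z :* (con (+ 1) :- x) :- con (+ 1))) (from i) (from j) (from j′))))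

  -- The map has order 3 in PGL₂; the orbit through infinity is ∞, 0, 1.
  Step-cyclic : ∀ {i j k} → Step i j → Step j k → Step k i
  Step-cyclic {zero}  {zero}  {_}     1≈0 _   = contradiction 1≈0 1≉0
  Step-cyclic {zero}  {suc j} {zero}  eq eq′ = contradiction (trans (sym eq′) eq) 1≉0
  Step-cyclic {zero}  {suc j} {suc k} eq eq′ = modulo₂ eq eq′
    (solve 2 (λ y z → z := con (+ 1) :+ z :* (y :- con (+ 0)) :+ con (+ 1) :* (z :* (con (+ 1) :- y) :- con (+ 1)))
      (from j) (from k))
  Step-cyclic {suc i} {zero}  {zero}  _  1≈0 = contradiction 1≈0 1≉0
  Step-cyclic {suc i} {zero}  {suc k} eq eq′ = modulo₂ eq eq′
    (solve 2 (λ x z → x :* (con (+ 1) :- z) := con (+ 1) :+ con (+ 1) :* (x :- con (+ 1)) :+ (:- x) :* (z :- con (+ 0)))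
      (from i) (from k))
  Step-cyclic {suc i} {suc j} {zero}  eq eq′ = modulo₂ eq eq′
    (solve 2 (λ x y → x := con (+ 0) :+ :- con (+ 1) :* (y :* (con (+ 1) :- x) :- con (+ 1))
      :+ (con (+ 1) :- x) :* (y :- con (+ 1))) (from i) (from j))
  Step-cyclic {suc i} {suc j} {suc k} eq eq′ = modulo₂ eq eq′
    (solve 3 (λ x y z → x :* (con (+ 1) :- z) :=
      con (+ 1) :+ (con (+ 1) :- x :* (con (+ 1) :- z) :+ (con (+ 1) :- x) :* (z :- con (+ 1))) :* (y :* (con (+ 1) :- x) :- con (+ 1))
      :+ (con (+ 1) :- x) :* (z :* (con (+ 1) :- y) :- con (+ 1)))
      (from i) (from j) (from k))

  -- A fixed point x satisfies x² - x + 1 = 0, so -x is the root sought. Without fixed points 3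
  -- would divide the number q + 1 of points of the projective line, which is 2 modulo 3.
  ω-exists : ∃ λ ω → ω ^ 2 + ω + 1# ≈ 0#
  ω-exists with any? (λ x → x ^ 2 + x + 1# ≟ 0#)
    (λ x≈y eq → trans (sym (congruence 1 (λ x → x :^ 2 :+ x :+ con (+ 1)) (x≈y ∷ []))) eq)
  ... | yes ∃ω = ∃ω
  ... | no  ∄ω = contradiction (cyclicRelation⇒3∣ Step Step-total
      (λ {i} → Step-functional {i}) (λ {i} {j} {k} → Step-cyclic {i} {j} {k}) (λ {i} → irrefl {i})) 3∤1+q
    where
    irrefl : ∀ {i} → ¬ Step i i
    irrefl {zero}  1≈0 = 1≉0 1≈0
    irrefl {suc i} eq  = ∄ω (- from i , modulo₁ eq
      (solve 1 (λ x → (:- x) :^ 2 :+ (:- x) :+ con (+ 1) :=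
        con (+ 0) :+ :- con (+ 1) :* (x :* (con (+ 1) :- x) :- con (+ 1))) (from i)))

  primitiveCubeRoot : PrimitiveCubeRoot F
  primitiveCubeRoot = record
    { ⅓        = (3 · 1#) ⁻¹
    ; 3*⅓≈1    = *-inverseʳ 3≉0
    ; ω        = proj₁ ω-exists
    ; ω²+ω+1≈0 = proj₂ ω-exists
    }

-- Cube roots of unity and the fibres of the quartic function v.

module CubeRootsOfUnity (F : FiniteField c ℓ₁ ℓ₂) (ρ : PrimitiveCubeRoot F) where

  open FiniteField F hiding (zero)
  open FieldProperties F
  open PrimitiveCubeRoot ρ

  3≉0 : ¬ (3 · 1# ≈ 0#)
  3≉0 3≈0 = 1≉0 (trans (sym 3*⅓≈1) (trans (*-congʳ 3≈0) (zeroˡ ⅓)))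

  9≉0 : ¬ (9 · 1# ≈ 0#)
  9≉0 9≈0 = ≉0-* 3≉0 3≉0 (trans (solve 0 (3 :× con (+ 1) :* 3 :× con (+ 1) := 9 :× con (+ 1))) 9≈0)

  ζ : Fin 3 → Carrier
  ζ zero             = 1#
  ζ (suc zero)       = ω
  ζ (suc (suc zero)) = ω ^ 2

  ζ³≈1 : ∀ i → ζ i ^ 3 ≈ 1#
  ζ³≈1 zero             = solve 0 (con (+ 1) :^ 3 := con (+ 1))
  ζ³≈1 (suc zero)       = modulo₁ ω²+ω+1≈0
    (solve 1 (λ ω → ω :^ 3 := con (+ 1) :+ (ω :- con (+ 1)) :* (ω :^ 2 :+ ω :+ con (+ 1) :- con (+ 0))) ω)
  ζ³≈1 (suc (suc zero)) = modulo₁ ω²+ω+1≈0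
    (solve 1 (λ ω → (ω :^ 2) :^ 3 := con (+ 1) :+
      (ω :^ 3 :+ con (+ 1)) :* (ω :- con (+ 1)) :* (ω :^ 2 :+ ω :+ con (+ 1) :- con (+ 0))) ω)

  private
    ω≉1 : ¬ (ω ≈ 1#)
    ω≉1 eq = 3≉0 (modulo₂ ω²+ω+1≈0 eq (solve 1 (λ ω → 3 :× con (+ 1) := con (+ 0)
      :+ con (+ 1) :* (ω :^ 2 :+ ω :+ con (+ 1) :- con (+ 0)) :+ (:- (ω :+ con (+ 2))) :* (ω :- con (+ 1))) ω))

    ω²≉1 : ¬ (ω ^ 2 ≈ 1#)
    ω²≉1 eq = 3≉0 (modulo₂ ω²+ω+1≈0 eq (solve 1 (λ ω → 3 :× con (+ 1) := con (+ 0)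
      :+ (con (+ 2) :- ω) :* (ω :^ 2 :+ ω :+ con (+ 1) :- con (+ 0)) :+ (ω :- con (+ 1)) :* (ω :^ 2 :- con (+ 1))) ω))

    ω²≉ω : ¬ (ω ^ 2 ≈ ω)
    ω²≉ω eq = 3≉0 (modulo₂ ω²+ω+1≈0 eq (solve 1 (λ ω → 3 :× con (+ 1) := con (+ 0)
      :+ (con (+ 3) :- 2 :× ω) :* (ω :^ 2 :+ ω :+ con (+ 1) :- con (+ 0)) :+ (2 :× ω :+ con (+ 1)) :* (ω :^ 2 :- ω)) ω))

  -- Differences of distinct cube roots of unity divide 3, so each coincidence would give 3 = 0.
  ζ-injective : ∀ {i j} → ζ i ≈ ζ j → i ≡ j
  ζ-injective {zero}           {zero}           _  = ≡.refl
  ζ-injective {zero}           {suc zero}       eq = contradiction (sym eq) ω≉1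
  ζ-injective {zero}           {suc (suc zero)} eq = contradiction (sym eq) ω²≉1
  ζ-injective {suc zero}       {zero}           eq = contradiction eq ω≉1
  ζ-injective {suc zero}       {suc zero}       _  = ≡.refl
  ζ-injective {suc zero}       {suc (suc zero)} eq = contradiction (sym eq) ω²≉ω
  ζ-injective {suc (suc zero)} {zero}           eq = contradiction eq ω²≉1
  ζ-injective {suc (suc zero)} {suc zero}       eq = contradiction eq ω²≉ω
  ζ-injective {suc (suc zero)} {suc (suc zero)} _  = ≡.refl

  private
    some-factor : ∀ {a} {A : Set a} {x y z} →
      (x ≈ 0# → A) → (y ≈ 0# → A) → (z ≈ 0# → A) → x * (y * z) ≈ 0# → A
    some-factor f g h eq = Sum.[ f , (λ yz≈0 → Sum.[ g , h ]′ (zero-product yz≈0)) ]′ (zero-product eq)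

    difference-zero : ∀ {x y} → x - y ≈ 0# → x ≈ y
    difference-zero {x} {y} eq = modulo₁ eq
      (solve 2 (λ x y → x := y :+ con (+ 1) :* (x :- y :- con (+ 0))) x y)

  -- Given ω, the difference x³ - y³ splits into the linear factors x - ζy.
  equal-cubes : ∀ {x y} → x ^ 3 ≈ y ^ 3 → ∃ λ i → x ≈ ζ i * y
  equal-cubes {x} {y} x³≈y³ = some-factor
    (λ eq → zero , difference-zero eq)
    (λ eq → suc zero , difference-zero eq)
    (λ eq → suc (suc zero) , difference-zero eq)
    (modulo₂ x³≈y³ ω²+ω+1≈0 (solve 3 (λ x y ω →
      (x :- con (+ 1) :* y) :* ((x :- ω :* y) :* (x :- ω :^ 2 :* y)) :=
      con (+ 0) :+ con (+ 1) :* (x :^ 3 :- y :^ 3) :+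
        (x :* y :^ 2 :* ω :- y :^ 3 :* ω :- x :^ 2 :* y :+ y :^ 3) :* (ω :^ 2 :+ ω :+ con (+ 1) :- con (+ 0)))
      x y ω))

  unit-cube : ∀ {x} → x ^ 3 ≈ 1# → ∃ λ i → x ≈ ζ i
  unit-cube {x} eq = let i , x≈ζ*1 = equal-cubes {x} {1#} (trans eq (sym (ζ³≈1 zero)))
                     in i , trans x≈ζ*1 (*-identityʳ _)

  -- The three exchanges m = ζ(l + 2ζ)/(l - ζ), together with the identity,
  -- form a Klein four-group, the deck group of l ↦ l(l³ + 8)/(l³ - 1).
  Exchange : (z l m : Carrier) → Set ℓ₁
  Exchange z l m = m * (l - z) ≈ z * (l + 2 · z)

  -- The graph of v with its denominator cleared. The equation by itself excludes the poles l³ = 1.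
  Quartic : (l v : Carrier) → Set ℓ₁
  Quartic l v = l * (l ^ 3 + 8 · 1#) ≈ v * (l ^ 3 - 1#)

  Quartic? : ∀ l v → Dec (Quartic l v)
  Quartic? l v = l * (l ^ 3 + 8 · 1#) ≟ v * (l ^ 3 - 1#)

  Quartic-resp : ∀ {l l′ v v′} → l ≈ l′ → v ≈ v′ → Quartic l v → Quartic l′ v′
  Quartic-resp l≈l′ v≈v′ eq =
    trans (sym (congruence 1 (λ l → l :* (l :^ 3 :+ 8 :× con (+ 1))) (l≈l′ ∷ [])))
    (trans eq (congruence 2 (λ l v → v :* (l :^ 3 :- con (+ 1))) (l≈l′ ∷ v≈v′ ∷ [])))

  -- At a pole the right side vanishes while the left side is 9l; but l = 0 is not a pole.
  Quartic⇒l³≉1 : ∀ {l v} → Quartic l v → ¬ (l ^ 3 ≈ 1#)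
  Quartic⇒l³≉1 {l} {v} eq l³≈1 = 1≉0 (modulo₂ l³≈1 l≈0
    (solve 1 (λ l → con (+ 1) := con (+ 0) :+ :- con (+ 1) :* (l :^ 3 :- con (+ 1)) :+ l :^ 2 :* (l :- con (+ 0))) l))
    where
    l≈0 : l ≈ 0#
    l≈0 = cancel 9≉0 (modulo₂ eq l³≈1 (solve 2 (λ l v → 9 :× con (+ 1) :* l := con (+ 0)
      :+ con (+ 1) :* (l :* (l :^ 3 :+ 8 :× con (+ 1)) :- v :* (l :^ 3 :- con (+ 1)))
      :+ (v :- l) :* (l :^ 3 :- con (+ 1))) l v))

  l³-1≉0 : ∀ {l} → ¬ (l ^ 3 ≈ 1#) → ¬ (l ^ 3 - 1# ≈ 0#)
  l³-1≉0 l³≉1 eq = l³≉1 (difference-zero eq)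

  l-z≉0 : ∀ {l z} → z ^ 3 ≈ 1# → ¬ (l ^ 3 ≈ 1#) → ¬ (l - z ≈ 0#)
  l-z≉0 {l} {z} z³≈1 l³≉1 eq = l³≉1 (modulo₂ eq z³≈1
    (solve 2 (λ l z → l :^ 3 := con (+ 1) :+ (l :^ 2 :+ l :* z :+ z :^ 2) :* (l :- z :- con (+ 0))
      :+ con (+ 1) :* (z :^ 3 :- con (+ 1))) l z))

  Quartic-value : ∀ {l} → ¬ (l ^ 3 ≈ 1#) → ∃ (Quartic l)
  Quartic-value {l} l³≉1 = l * (l ^ 3 + 8 · 1#) * (l ^ 3 - 1#) ⁻¹ , modulo₁ (*-inverseʳ (l³-1≉0 l³≉1))
    (solve 2 (λ l d → l :* (l :^ 3 :+ 8 :× con (+ 1)) :=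
      l :* (l :^ 3 :+ 8 :× con (+ 1)) :* d :* (l :^ 3 :- con (+ 1))
      :+ (:- (l :* (l :^ 3 :+ 8 :× con (+ 1)))) :* ((l :^ 3 :- con (+ 1)) :* d :- con (+ 1))) l ((l ^ 3 - 1#) ⁻¹))

  Quartic-functional : ∀ {l v v′} → Quartic l v → Quartic l v′ → v ≈ v′
  Quartic-functional {l} {v} {v′} eq eq′ = cancel-difference (l³-1≉0 (Quartic⇒l³≉1 eq)) (modulo₂ eq eq′
    (solve 3 (λ l v v′ → (l :^ 3 :- con (+ 1)) :* (v :- v′) := con (+ 0)
      :+ :- con (+ 1) :* (l :* (l :^ 3 :+ 8 :× con (+ 1)) :- v :* (l :^ 3 :- con (+ 1)))
      :+ con (+ 1) :* (l :* (l :^ 3 :+ 8 :× con (+ 1)) :- v′ :* (l :^ 3 :- con (+ 1)))) l v v′))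

  -- The numerator has degrees 4 and 1, both 1 modulo 3, and the denominator 3 and 0. So only v³ is
  -- invariant under rotation.
  Quartic-rotate : ∀ {z l v} → z ^ 3 ≈ 1# → Quartic l v → Quartic (z * l) (z * v)
  Quartic-rotate {z} {l} {v} z³≈1 eq = modulo₂ z³≈1 eq
    (solve 3 (λ z l v → (z :* l) :* ((z :* l) :^ 3 :+ 8 :× con (+ 1)) :=
      (z :* v) :* ((z :* l) :^ 3 :- con (+ 1))
      :+ (z :* l :^ 4 :- z :* v :* l :^ 3) :* (z :^ 3 :- con (+ 1))
      :+ z :* (l :* (l :^ 3 :+ 8 :× con (+ 1)) :- v :* (l :^ 3 :- con (+ 1)))) z l v)

  -- Multiplied by (l - z)⁴, the relation at `m` becomes 9z times the relation at `l`, up to a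
  -- multiple of z³ - 1.
  Quartic-exchange : ∀ {z l m v} → z ^ 3 ≈ 1# → Exchange z l m → Quartic l v → Quartic m v
  Quartic-exchange {z} {l} {m} {v} z³≈1 ex eq =
    cancel-difference (≉0-* (≉0-* d≉0 d≉0) (≉0-* d≉0 d≉0)) (modulo₃ ex eq z³≈1
      (solve 4 (λ z l m v → let d = l :- z ; x = m :* d ; y = z :* (l :+ 2 :× z) in
        d :* d :* (d :* d) :* (m :* (m :^ 3 :+ 8 :× con (+ 1)) :- v :* (m :^ 3 :- con (+ 1))) := con (+ 0)
        :+ (x :^ 3 :+ x :^ 2 :* y :+ x :* y :^ 2 :+ y :^ 3 :+ 8 :× d :^ 3
            :- v :* d :* (x :^ 2 :+ x :* y :+ y :^ 2)) :* (x :- y)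
        :+ 9 :× z :* (l :* (l :^ 3 :+ 8 :× con (+ 1)) :- v :* (l :^ 3 :- con (+ 1)))
        :+ (4 :× (l :* v :* z :^ 3) :+ 32 :× (l :* z :^ 4) :- 6 :× (l :^ 2 :* v :* z :^ 2)
            :+ 24 :× (l :^ 2 :* z :^ 3) :- 5 :× (l :^ 3 :* v :* z) :+ 8 :× (l :^ 3 :* z :^ 2)
            :- l :^ 4 :* v :+ l :^ 4 :* z :+ 8 :× (v :* z :^ 4) :+ 16 :× z :^ 5
            :+ 72 :× (l :* z) :+ 9 :× (v :* z)) :* (z :^ 3 :- con (+ 1)))
        z l m v))
    where
    d≉0 : ¬ (l - z ≈ 0#)
    d≉0 = l-z≉0 z³≈1 (Quartic⇒l³≉1 eq)

  private
    -- The splitting of x³ + y³ + z³ - 3xyz into linear forms, taken at (a, -b, -2).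
    norm : ∀ a b → (a - 1# * b - 2 · 1# ^ 2) * ((a - ω * b - 2 · ω ^ 2) * (a - ω ^ 2 * b - 2 · (ω ^ 2) ^ 2)) ≈
      a ^ 3 - b ^ 3 - 6 · (a * b) - 8 · 1#
    norm a b = modulo₁ ω²+ω+1≈0 (solve 3 (λ ω a b →
        (a :- con (+ 1) :* b :- 2 :× con (+ 1) :^ 2) :*
          ((a :- ω :* b :- 2 :× ω :^ 2) :* (a :- ω :^ 2 :* b :- 2 :× (ω :^ 2) :^ 2)) :=
        a :^ 3 :- b :^ 3 :- 6 :× (a :* b) :- 8 :× con (+ 1) :+
          (2 :× (a :* b :* ω :^ 3) :+ 4 :× (a :* ω :^ 4) :- 4 :× (b :* ω :^ 4) :- 2 :× (b :^ 2 :* ω :^ 3)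
            :+ 2 :× (a :* b :* ω :^ 2) :+ a :* b :^ 2 :* ω :- 4 :× (a :* ω :^ 3) :- 2 :× (a :^ 2 :* ω :^ 2)
            :- b :^ 3 :* ω :- 8 :× ω :^ 4 :- 4 :× (a :* b :* ω) :+ 4 :× (a :* ω :^ 2) :- a :^ 2 :* b :+ 2
            :× (a :^ 2 :* ω) :+ b :^ 3 :+ 8 :× ω :^ 3 :+ 6 :× (a :* b) :- 2 :× a :^ 2 :- 8 :× ω :+ con (+
            8))
          :* (ω :^ 2 :+ ω :+ con (+ 1) :- con (+ 0))) ω a b)

    -- Elimination of `v` leaves a multiple of m - l. The cofactor is the norm of ml - ζ(m + l) -
    -- 2ζ², which is the exchange relation written symmetrically in `l` and `m`.
    difference*norm≈0 : ∀ {l m v} → Quartic l v → Quartic m v →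
      (m - l) * ((m * l) ^ 3 - (m + l) ^ 3 - 6 · (m * l * (m + l)) - 8 · 1#) ≈ 0#
    difference*norm≈0 {l} {m} {v} eq eq′ = modulo₂ eq eq′ (solve 3 (λ l m v →
      (m :- l) :* ((m :* l) :^ 3 :- (m :+ l) :^ 3 :- 6 :× (m :* l :* (m :+ l)) :- 8 :× con (+ 1)) := con (+ 0)
      :+ (con (+ 1) :- m :^ 3) :* (l :* (l :^ 3 :+ 8 :× con (+ 1)) :- v :* (l :^ 3 :- con (+ 1)))
      :+ (l :^ 3 :- con (+ 1)) :* (m :* (m :^ 3 :+ 8 :× con (+ 1)) :- v :* (m :^ 3 :- con (+ 1))))
      l m v)

    exchange : ∀ {z l m} → m * l - z * (m + l) - 2 · z ^ 2 ≈ 0# → Exchange z l m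
    exchange {z} {l} {m} eq = modulo₁ eq (solve 3 (λ l m z → m :* (l :- z) := z :* (l :+ 2 :× z) :+
      con (+ 1) :* (m :* l :- z :* (m :+ l) :- 2 :× z :^ 2 :- con (+ 0))) l m z)

    exchange-factor : ∀ {l m} → (m * l) ^ 3 - (m + l) ^ 3 - 6 · (m * l * (m + l)) - 8 · 1# ≈ 0# →
      ∃ λ i → Exchange (ζ i) l m
    exchange-factor {l} {m} eq = some-factor
      (λ eq → zero , exchange eq)
      (λ eq → suc zero , exchange eq)
      (λ eq → suc (suc zero) , exchange eq)
      (trans (norm (m * l) (m + l)) eq)

  Quartic-fibre : ∀ {l m v} → Quartic l v → Quartic m v → m ≈ l ⊎ ∃ λ i → Exchange (ζ i) l m
  Quartic-fibre eq eq′ = Sum.map difference-zero exchange-factor (zero-product (difference*norm≈0 eq eq′))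

-- Isomorphisms within the Hesse pencil.

module HessePencil (F : FiniteField c ℓ₁ ℓ₂) (ρ : PrimitiveCubeRoot F) where

  open FiniteField F hiding (zero)
  open FieldProperties F
  open EllipticCurves F
  open Isomorphisms F
  open IsomorphismRelation F
  open PrimitiveCubeRoot ρ
  open CubeRootsOfUnity F ρ
  open WeierstrassEquation using (Δ)

  hesseEquation : Carrier → WeierstrassEquation
  hesseEquation l = record { a₁ = 3 · l ; a₂ = 0# ; a₃ = l ^ 3 - 1# ; a₄ = 0# ; a₆ = 0# }

  hesse-Δ : ∀ l → Δ (hesseEquation l) ≈ 3 · 1# * (9 · 1#) * ((l ^ 3 - 1#) * ((l ^ 3 - 1#) * (l ^ 3 - 1#)))
  hesse-Δ = solve 1 λ l → let
      o = con (+ 0)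
      A₁ = 3 :× l
      A₃ = l :^ 3 :- con (+ 1)
      B₂ = A₁ :^ 2 :+ 4 :× o
      B₄ = 2 :× o :+ A₁ :* A₃
      B₆ = A₃ :^ 2 :+ 4 :× o
      B₈ = A₁ :^ 2 :* o :+ 4 :× (o :* o) :- A₁ :* A₃ :* o :+ o :* A₃ :^ 2 :- o :^ 2
    in :- (B₂ :^ 2 :* B₈) :- 8 :× B₄ :^ 3 :- 27 :× B₆ :^ 2 :+ 9 :× (B₂ :* B₄ :* B₆) :=
       3 :× con (+ 1) :* (9 :× con (+ 1)) :* (A₃ :* (A₃ :* A₃))

  hesse-c₄ : ∀ l → c₄ (hesseEquation l) ≈ 9 · 1# * (l * (l ^ 3 + 8 · 1#))
  hesse-c₄ = solve 1 λ l → let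
      A₁ = 3 :× l
      A₃ = l :^ 3 :- con (+ 1)
    in (A₁ :^ 2 :+ 4 :× con (+ 0)) :^ 2 :- 24 :× (2 :× con (+ 0) :+ A₁ :* A₃) :=
       9 :× con (+ 1) :* (l :* (l :^ 3 :+ 8 :× con (+ 1)))

  hesse : ∀ l → ¬ (l ^ 3 ≈ 1#) → EllipticCurve
  hesse l l³≉1 = record
    { equation    = hesseEquation l
    ; nonsingular = λ Δ≈0 → ≉0-* (≉0-* 3≉0 9≉0) (≉0-* d≉0 (≉0-* d≉0 d≉0)) (trans (sym (hesse-Δ l)) Δ≈0)
    }
    where
    d≉0 : ¬ (l ^ 3 - 1# ≈ 0#)
    d≉0 = l³-1≉0 l³≉1

  -- The j-invariant of hesse l is 27 v³.
  hesse-≅⇒v³ : ∀ {l m v w} l³≉1 m³≉1 → Quartic l v → Quartic m w →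
    hesse l l³≉1 ≅ hesse m m³≉1 → v ^ 3 ≈ w ^ 3
  hesse-≅⇒v³ {l} {m} {v} {w} l³≉1 m³≉1 Ql Qm φ =
    cancel-difference (≉0-* (≉0-* 9≉0 (≉0-* 9≉0 9≉0)) (≉0-* (≉0-* (≉0-* 3≉0 9≉0) (cube≉0 m³≉1)) (cube≉0 l³≉1))) final
    where
    open _≅_ φ using (u)
    cube≉0 : ∀ {x} → ¬ (x ^ 3 ≈ 1#) → ¬ ((x ^ 3 - 1#) * ((x ^ 3 - 1#) * (x ^ 3 - 1#)) ≈ 0#)
    cube≉0 x³≉1 = ≉0-* (l³-1≉0 x³≉1) (≉0-* (l³-1≉0 x³≉1) (l³-1≉0 x³≉1))
    c₄-eq : ∀ {x y} → Quartic x y → c₄ (hesseEquation x) ≈ 9 · 1# * (y * (x ^ 3 - 1#))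
    c₄-eq Q = trans (hesse-c₄ _) (*-congˡ Q)
    c₄-relation : u ^ 4 * (9 · 1# * (w * (m ^ 3 - 1#))) ≈ 9 · 1# * (v * (l ^ 3 - 1#))
    c₄-relation = trans (*-congˡ (sym (c₄-eq Qm))) (trans (c₄-law φ) (c₄-eq Ql))
    Δ-relation : u ^ 12 * (3 · 1# * (9 · 1#) * ((m ^ 3 - 1#) * ((m ^ 3 - 1#) * (m ^ 3 - 1#)))) ≈
      3 · 1# * (9 · 1#) * ((l ^ 3 - 1#) * ((l ^ 3 - 1#) * (l ^ 3 - 1#)))
    Δ-relation = trans (*-congˡ (sym (hesse-Δ m))) (trans (Δ-law φ) (hesse-Δ l))
    -- The equality of c₄³/Δ on both sides, cross-multiplied: u drops out since c₄³ and Δ both have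
    -- weight 12.
    final : 9 · 1# * (9 · 1# * (9 · 1#)) * (3 · 1# * (9 · 1#) * ((m ^ 3 - 1#) * ((m ^ 3 - 1#) * (m ^ 3 - 1#)))
      * ((l ^ 3 - 1#) * ((l ^ 3 - 1#) * (l ^ 3 - 1#)))) * (v ^ 3 - w ^ 3) ≈ 0#
    final = modulo₂ c₄-relation Δ-relation (solve 5 (λ u v w d e → let
        A = u :^ 4 :* (9 :× con (+ 1) :* (w :* e))
        B = 9 :× con (+ 1) :* (v :* d)
        f = 3 :× con (+ 1) :* (9 :× con (+ 1)) :* (e :* (e :* e))
        g = 3 :× con (+ 1) :* (9 :× con (+ 1)) :* (d :* (d :* d))
      in 9 :× con (+ 1) :* (9 :× con (+ 1) :* (9 :× con (+ 1))) :* (f :* (d :* (d :* d))) :* (v :^ 3 :- w :^ 3) :=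
        con (+ 0) :+ (:- (f :* (A :^ 2 :+ A :* B :+ B :^ 2))) :* (A :- B)
        :+ 9 :× con (+ 1) :* (9 :× con (+ 1) :* (9 :× con (+ 1))) :* (w :^ 3 :* (e :* (e :* e))) :* (u :^ 12 :* f :- g))
      u v w (l ^ 3 - 1#) (m ^ 3 - 1#))

  -- A pure scaling by z² = 1/z: it multiplies the parameter in a₁ by z, and fixes a₃ because its
  -- cube is 1.
  rotation-≅ : ∀ {z l m} l³≉1 m³≉1 → z ^ 3 ≈ 1# → m ≈ z * l → hesse l l³≉1 ≅ hesse m m³≉1
  rotation-≅ {z} {l} {m} l³≉1 m³≉1 z³≈1 m≈zl = ≈ʷ⇒≅ (z ^ 2) 0# 0# 0#
    (λ z²≈0 → 1≉0 (modulo₂ z³≈1 z²≈0 (solve 1 (λ z → con (+ 1) := con (+ 0) :+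
      :- con (+ 1) :* (z :^ 3 :- con (+ 1)) :+ z :* (z :^ 2 :- con (+ 0))) z)))
    ( modulo₂ z³≈1 m≈zl (solve 3 (λ z l m → z :^ 2 :* 3 :× m := 3 :× l :+ 2 :× con (+ 0)
        :+ 3 :× l :* (z :^ 3 :- con (+ 1)) :+ 3 :× z :^ 2 :* (m :- z :* l)) z l m)
    ∷ solve 2 (λ z l → (z :^ 2) :^ 2 :* con (+ 0) :=
        con (+ 0) :- con (+ 0) :* 3 :× l :+ 3 :× con (+ 0) :- con (+ 0) :^ 2) z l
    ∷ modulo₂ z³≈1 m≈zl (solve 3 (λ z l m → (z :^ 2) :^ 3 :* (m :^ 3 :- con (+ 1)) :=
        l :^ 3 :- con (+ 1) :+ con (+ 0) :* 3 :× l :+ 2 :× con (+ 0)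
        :+ ((z :^ 6 :+ z :^ 3 :+ con (+ 1)) :* l :^ 3 :- z :^ 3 :- con (+ 1)) :* (z :^ 3 :- con (+ 1))
        :+ z :^ 6 :* (m :^ 2 :+ m :* z :* l :+ (z :* l) :^ 2) :* (m :- z :* l)) z l m)
    ∷ solve 2 (λ z l → (z :^ 2) :^ 4 :* con (+ 0) :=
        con (+ 0) :- con (+ 0) :* (l :^ 3 :- con (+ 1)) :+ 2 :× (con (+ 0) :* con (+ 0))
        :- (con (+ 0) :+ con (+ 0) :* con (+ 0)) :* 3 :× l :+ 3 :× con (+ 0) :^ 2
        :- 2 :× (con (+ 0) :* con (+ 0))) z l
    ∷ solve 2 (λ z l → (z :^ 2) :^ 6 :* con (+ 0) :=
        con (+ 0) :+ con (+ 0) :* con (+ 0) :+ con (+ 0) :^ 2 :* con (+ 0) :+ con (+ 0) :^ 3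
        :- con (+ 0) :* (l :^ 3 :- con (+ 1)) :- con (+ 0) :^ 2 :- con (+ 0) :* con (+ 0) :* 3 :× l) z l
    ∷ [])

  -- 2ω + 1 is a square root of -3.
  θ≉0 : ¬ (2 · ω + 1# ≈ 0#)
  θ≉0 θ≈0 = 3≉0 (modulo₂ θ≈0 ω²+ω+1≈0 (solve 1 (λ ω → 3 :× con (+ 1) := con (+ 0)
    :+ (:- (2 :× ω :+ con (+ 1))) :* (2 :× ω :+ con (+ 1) :- con (+ 0))
    :+ con (+ 4) :* (ω :^ 2 :+ ω :+ con (+ 1) :- con (+ 0))) ω))

  private
    ⅓≉0 : ¬ (⅓ ≈ 0#)
    ⅓≉0 ⅓≈0 = 1≉0 (trans (sym 3*⅓≈1) (trans (*-congˡ ⅓≈0) (zeroʳ _)))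

  -- Moving the origin from (0 , 0) to the flex (- (l² + l + 1) , (l² + l + 1)(l - ω²)).
  exchange₁-≅ : ∀ {l m} l³≉1 m³≉1 → Exchange 1# l m → hesse l l³≉1 ≅ hesse m m³≉1
  exchange₁-≅ {l} {m} l³≉1 m³≉1 ex = ≈ʷ⇒≅
    -- With θ = 2ω + 1, the coefficient a₁ at the new origin is -θ(l + 2) = -θm(l - 1); this value
    -- of u makes it 3um.
    (- (2 · ω + 1#) * (l - 1#) * ⅓)
    (- (l ^ 2 + l + 1#))
    (- (2 · ω + 1#) * (1# - ω * l))
    ((l ^ 2 + l + 1#) * (l + 1# + ω))
    (≉0-* (≉0-* (λ -θ≈0 → θ≉0 (modulo₁ -θ≈0 (solve 1 (λ x → x := con (+ 0) :+ :- con (+ 1) :* (:- x :- con (+ 0))) _)))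
      (l-z≉0 (ζ³≈1 zero) l³≉1)) ⅓≉0)
    ( modulo₃ ω²+ω+1≈0 3*⅓≈1 ex (solve 4 (λ l m ω t → let open Data l m ω t in
        u :* 3 :× m := a₁ :+ 2 :× s
        :+ (:- (4 :× l)) :* (W :- con (+ 0)) :+ (:- θ :* Y) :* (3 :× con (+ 1) :* t :- con (+ 1))
        :+ (:- (3 :× θ) :* t) :* (X :- Y′)) l m ω ⅓)
    ∷ modulo₁ ω²+ω+1≈0 (solve 4 (λ l m ω t → let open Data l m ω t in
        u :^ 2 :* o := o :- s :* a₁ :+ 3 :× r :- s :^ 2
        :+ (4 :× (l :^ 2 :* ω :^ 2) :- 8 :× (l :* ω) :+ 3 :× l :^ 2 :+ con (+ 4)) :* (W :- con (+ 0))) l m ω ⅓)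
    ∷ modulo₃ ω²+ω+1≈0 3*⅓≈1 ex (solve 4 (λ l m ω t → let open Data l m ω t in
        u :^ 3 :* (m :^ 3 :- con (+ 1)) := a₃ :+ r :* a₁ :+ 2 :× T′
        :+ (:- (36 :× θ :* L :* t :^ 3)) :* (W :- con (+ 0))
        :+ θ :* L :* (9 :× t :^ 2 :+ 3 :× t :+ con (+ 1)) :* (3 :× con (+ 1) :* t :- con (+ 1))
        :+ (:- (θ :^ 3 :* t :^ 3)) :* (X :^ 2 :+ X :* Y :+ Y :^ 2) :* (X :- Y′)) l m ω ⅓)
    ∷ modulo₁ ω²+ω+1≈0 (solve 4 (λ l m ω t → let open Data l m ω t in
        u :^ 4 :* o := o :- s :* a₃ :+ 2 :× (r :* o) :- (T′ :+ r :* s) :* a₁ :+ 3 :× r :^ 2 :- 2 :× (s :* T′)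
        :+ 4 :× (l :^ 3 :* ω :+ l :^ 2 :* ω :+ l :* ω :- l :^ 2 :- l :- con (+ 1)) :* (W :- con (+ 0))) l m ω ⅓)
    ∷ modulo₁ ω²+ω+1≈0 (solve 4 (λ l m ω t → let open Data l m ω t in
        u :^ 6 :* o := o :+ r :* o :+ r :^ 2 :* o :+ r :^ 3 :- T′ :* a₃ :- T′ :^ 2 :- r :* T′ :* a₁
        :+ L :^ 2 :* (W :- con (+ 0))) l m ω ⅓)
    ∷ [])
    where
    module Data {n} (l m ω t : Polynomial n) where
      o W L θ u r s T′ a₁ a₃ X Y Y′ : Polynomial n
      o = con (+ 0)
      W = ω :^ 2 :+ ω :+ con (+ 1)
      L = l :^ 2 :+ l :+ con (+ 1)
      θ = 2 :× ω :+ con (+ 1)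
      u = :- θ :* (l :- con (+ 1)) :* t
      r = :- L
      s = :- θ :* (con (+ 1) :- ω :* l)
      T′ = L :* (l :+ con (+ 1) :+ ω)
      a₁ = 3 :× l
      a₃ = l :^ 3 :- con (+ 1)
      X = m :* (l :- con (+ 1))
      Y = l :+ con (+ 2)
      Y′ = con (+ 1) :* (l :+ 2 :× con (+ 1))

  rotated³≉1 : ∀ {z l} → z ^ 3 ≈ 1# → ¬ (l ^ 3 ≈ 1#) → ¬ ((z * l) ^ 3 ≈ 1#)
  rotated³≉1 {z} {l} z³≈1 l³≉1 eq = l³≉1 (modulo₂ eq z³≈1
    (solve 2 (λ z l → l :^ 3 := con (+ 1) :+ con (+ 1) :* ((z :* l) :^ 3 :- con (+ 1))
      :+ (:- (l :^ 3)) :* (z :^ 3 :- con (+ 1))) z l))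

  square³≈1 : ∀ {z} → z ^ 3 ≈ 1# → (z ^ 2) ^ 3 ≈ 1#
  square³≈1 {z} z³≈1 = modulo₁ z³≈1
    (solve 1 (λ z → (z :^ 2) :^ 3 := con (+ 1) :+ (z :^ 3 :+ con (+ 1)) :* (z :^ 3 :- con (+ 1))) z)

  -- The exchange by z is the exchange by 1 conjugated with a rotation, so one explicit isomorphism
  -- serves all three.
  exchange-≅ : ∀ {z l m} l³≉1 m³≉1 → z ^ 3 ≈ 1# → Exchange z l m → hesse l l³≉1 ≅ hesse m m³≉1
  exchange-≅ {z} {l} {m} l³≉1 m³≉1 z³≈1 ex =
    ≅-trans (rotation-≅ l³≉1 l′³≉1 z⁶≈1 refl)
    (≅-trans (exchange₁-≅ l′³≉1 m′³≉1 (modulo₂ ex z³≈1 (solve 3 (λ z l m →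
        z :^ 2 :* m :* (z :^ 2 :* l :- con (+ 1)) := con (+ 1) :* (z :^ 2 :* l :+ 2 :× con (+ 1))
        :+ z :* (m :* (l :- z) :- z :* (l :+ 2 :× z)) :+ (z :* m :* l :+ con (+ 2)) :* (z :^ 3 :- con (+ 1))) z l m)))
      (rotation-≅ m′³≉1 m³≉1 z³≈1 (modulo₁ z³≈1 (solve 2 (λ z m → m := z :* (z :^ 2 :* m) :+
        (:- m) :* (z :^ 3 :- con (+ 1))) z m))))
    where
    z⁶≈1 : (z ^ 2) ^ 3 ≈ 1#
    z⁶≈1 = square³≈1 z³≈1
    l′³≉1 = rotated³≉1 z⁶≈1 l³≉1
    m′³≉1 = rotated³≉1 z⁶≈1 m³≉1

  -- A rotation of `l` removes the cube root of unity between `v` and `w`; the parameters then lie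
  -- in one fibre.
  v³⇒hesse-≅ : ∀ {l m v w} l³≉1 m³≉1 → Quartic l v → Quartic m w →
    v ^ 3 ≈ w ^ 3 → hesse l l³≉1 ≅ hesse m m³≉1
  v³⇒hesse-≅ {l} {m} {v} {w} l³≉1 m³≉1 Ql Qm v³≈w³ =
    ≅-trans (rotation-≅ l³≉1 l′³≉1 (ζ³≈1 i) refl)
      -- The rotation by 1 turns equality of parameters in the setoid into an isomorphism.
      (Sum.[ (λ m≈ → rotation-≅ {1#} l′³≉1 m³≉1 (ζ³≈1 zero) (trans m≈ (sym (*-identityˡ _))))
           , (λ (k , ex) → exchange-≅ l′³≉1 m³≉1 (ζ³≈1 k) ex) ]′
        (Quartic-fibre (Quartic-resp refl (sym w≈ζv) (Quartic-rotate (ζ³≈1 i) Ql)) Qm))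
    where
    root = equal-cubes (sym v³≈w³)
    i = proj₁ root
    w≈ζv : w ≈ ζ i * v
    w≈ζv = proj₂ root
    l′³≉1 = rotated³≉1 (ζ³≈1 i) l³≉1

-- 3-torsion points as flexes, and cyclicity in terms of their abscissas.

module ThreeTorsion (F : FiniteField c ℓ₁ ℓ₂) (E : EllipticCurves.EllipticCurve F) where

  open FiniteField F hiding (zero)
  open FieldProperties F
  open EllipticCurves F
  open EllipticCurve E

  G : RawGroup c (c ⊔ ℓ₁)
  G = rawGroup E

  open RawGroup G using () renaming (_≈_ to _≈ₚ_)

  tangent-numerator tangent-denominator : (x y : Carrier) → Carrier
  tangent-numerator   x y = 3 · x ^ 2 + 2 · (a₂ * x) + a₄ - a₁ * y
  tangent-denominator x y = 2 · y + a₁ * x + a₃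

  -- A finite point is 3-torsion exactly when its tangent meets the curve in no
  -- other point.
  record Flex (x y : Carrier) : Set (c ⊔ ℓ₁) where
    field
      onCurve       : y ^ 2 + a₁ * x * y + a₃ * y ≈ x ^ 3 + a₂ * x ^ 2 + a₄ * x + a₆
      denominator≉0 : ¬ (tangent-denominator x y ≈ 0#)
      slope         : Carrier
      slope-eq      : slope * tangent-denominator x y ≈ tangent-numerator x y
      third         : slope ^ 2 + a₁ * slope - a₂ - x - x ≈ x

  private
    denominator-cong : ∀ {x x′ y y′} → x ≈ x′ → y ≈ y′ → tangent-denominator x y ≈ tangent-denominator x′ y′
    denominator-cong x≈x′ y≈y′ = congruence 4 (λ a₁ a₃ x y → 2 :× y :+ a₁ :* x :+ a₃)
      (refl ∷ refl ∷ x≈x′ ∷ y≈y′ ∷ [])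

    numerator-cong : ∀ {x x′ y y′} → x ≈ x′ → y ≈ y′ → tangent-numerator x y ≈ tangent-numerator x′ y′
    numerator-cong x≈x′ y≈y′ = congruence 5
      (λ a₁ a₂ a₄ x y → 3 :× x :^ 2 :+ 2 :× (a₂ :* x) :+ a₄ :- a₁ :* y)
      (refl ∷ refl ∷ refl ∷ x≈x′ ∷ y≈y′ ∷ [])

  Flex-resp : ∀ {x x′ y y′} → x ≈ x′ → y ≈ y′ → Flex x y → Flex x′ y′
  Flex-resp x≈x′ y≈y′ P = record
    { onCurve = trans
        (sym (congruence 4 (λ a₁ a₃ x y → y :^ 2 :+ a₁ :* x :* y :+ a₃ :* y) (refl ∷ refl ∷ x≈x′ ∷ y≈y′ ∷ [])))
        (trans onCurve (congruence 4 (λ a₂ a₄ a₆ x → x :^ 3 :+ a₂ :* x :^ 2 :+ a₄ :* x :+ a₆)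
          (refl ∷ refl ∷ refl ∷ x≈x′ ∷ [])))
    ; denominator≉0 = λ eq → denominator≉0 (trans (denominator-cong x≈x′ y≈y′) eq)
    ; slope    = slope
    ; slope-eq = trans (*-congˡ (sym (denominator-cong x≈x′ y≈y′))) (trans slope-eq (numerator-cong x≈x′ y≈y′))
    ; third    = trans (+-cong (+-congˡ (-‿cong (sym x≈x′))) (-‿cong (sym x≈x′))) (trans third x≈x′)
    }
    where open Flex P

  Flex? : ∀ x y → Dec (Flex x y)
  Flex? x y = map′
    (λ (onCurve , denominator≉0 , slope , slope-eq , third) → record
      { onCurve = onCurve ; denominator≉0 = denominator≉0 ; slope = slope ; slope-eq = slope-eq ; third = third })
    (λ P → let open Flex P in onCurve , denominator≉0 , slope , slope-eq , third)
    ((_ ≟ _) ×-dec ¬? (tangent-denominator x y ≟ 0#) ×-dec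
      any? (λ m → (m * tangent-denominator x y ≟ tangent-numerator x y) ×-dec (m ^ 2 + a₁ * m - a₂ - x - x ≟ x))
        (λ m≈m′ (eq , eq′) → trans (*-congʳ (sym m≈m′)) eq ,
          trans (congruence 4 (λ a₁ a₂ x m → m :^ 2 :+ a₁ :* m :- a₂ :- x :- x)
            (refl ∷ refl ∷ refl ∷ sym m≈m′ ∷ [])) eq′))

  private
    y+y≈2y : ∀ x y → y + y + a₁ * x + a₃ ≈ tangent-denominator x y
    y+y≈2y x y = solve 4 (λ a₁ a₃ x y → y :+ y :+ a₁ :* x :+ a₃ := 2 :× y :+ a₁ :* x :+ a₃) a₁ a₃ x y

    tangent : (x y : Carrier) → Carrier
    tangent x y = tangent-numerator x y * tangent-denominator x y ⁻¹

  add-vertical : ∀ {x₁ y₁ x₂ y₂} → x₁ ≈ x₂ → y₁ + y₂ + a₁ * x₂ + a₃ ≈ 0# →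
    add E (just (x₁ , y₁)) (just (x₂ , y₂)) ≡ nothing
  add-vertical {x₁} {y₁} {x₂} {y₂} x₁≈x₂ opposite with x₁ ≟ x₂
  ... | no x₁≉x₂ = contradiction x₁≈x₂ x₁≉x₂
  ... | yes _ with y₁ + y₂ + a₁ * x₂ + a₃ ≟ 0#
  ...   | yes _ = ≡.refl
  ...   | no ¬opposite = contradiction opposite ¬opposite

  add-tangent : ∀ {x₁ y₁ x₂ y₂} → x₁ ≈ x₂ → ¬ (y₁ + y₂ + a₁ * x₂ + a₃ ≈ 0#) →
    add E (just (x₁ , y₁)) (just (x₂ , y₂)) ≡ chord E (tangent x₁ y₁) x₁ y₁ x₂
  add-tangent {x₁} {y₁} {x₂} {y₂} x₁≈x₂ ¬opposite with x₁ ≟ x₂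
  ... | no x₁≉x₂ = contradiction x₁≈x₂ x₁≉x₂
  ... | yes _ with y₁ + y₂ + a₁ * x₂ + a₃ ≟ 0#
  ...   | yes opposite = contradiction opposite ¬opposite
  ...   | no _ = ≡.refl

  add-distinct : ∀ {x₁ y₁ x₂ y₂} → ¬ (x₁ ≈ x₂) → ∃ λ P → add E (just (x₁ , y₁)) (just (x₂ , y₂)) ≡ just P
  add-distinct {x₁} {y₁} {x₂} {y₂} x₁≉x₂ with x₁ ≟ x₂
  ... | yes x₁≈x₂ = contradiction x₁≈x₂ x₁≉x₂
  ... | no _ = _ , ≡.refl

  private
    third-abscissa : (m x₁ x₂ : Carrier) → Carrier
    third-abscissa m x₁ x₂ = m ^ 2 + a₁ * m - a₂ - x₁ - x₂

    chord-ordinate : ∀ {m x x₃ y} → x₃ ≈ x → - (y + m * (x₃ - x)) - a₁ * x₃ - a₃ ≈ - y - a₁ * x - a₃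
    chord-ordinate {m} {x} {x₃} {y} x₃≈x = modulo₁ x₃≈x (solve 6 (λ a₁ a₃ m x x₃ y →
      :- (y :+ m :* (x₃ :- x)) :- a₁ :* x₃ :- a₃ := :- y :- a₁ :* x :- a₃ :+ (:- (m :+ a₁)) :* (x₃ :- x))
      a₁ a₃ m x x₃ y)

    opposite : ∀ {x x′ y y′} → x′ ≈ x → y′ ≈ - y - a₁ * x - a₃ → y + y′ + a₁ * x′ + a₃ ≈ 0#
    opposite {x} {x′} {y} {y′} x′≈x y′≈-y = modulo₂ x′≈x y′≈-y (solve 6 (λ a₁ a₃ x x′ y y′ →
      y :+ y′ :+ a₁ :* x′ :+ a₃ := con (+ 0) :+ a₁ :* (x′ :- x) :+
      con (+ 1) :* (y′ :- (:- y :- a₁ :* x :- a₃))) a₁ a₃ x x′ y y′)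

  module _ {x y} (P : Flex x y) where
    open Flex P

    private
      slope≈tangent : tangent x y ≈ slope
      slope≈tangent = modulo₂ slope-eq (*-inverseʳ denominator≉0) (solve 4 (λ m n d e →
        n :* e := m :+ (:- e) :* (m :* d :- n) :+ m :* (d :* e :- con (+ 1)))
        slope (tangent-numerator x y) (tangent-denominator x y) (tangent-denominator x y ⁻¹))

      tangent-third : ∀ {x′} → x′ ≈ x → third-abscissa (tangent x y) x x′ ≈ x
      tangent-third x′≈x = trans (congruence 5 (λ a₁ a₂ m x₁ x₂ → m :^ 2 :+ a₁ :* m :- a₂ :- x₁ :- x₂)
        (refl {a₁} ∷ refl {a₂} ∷ slope≈tangent ∷ refl {x} ∷ x′≈x ∷ [])) third

    -- The points O, P, -P up to equality of coordinates. Adding P permutes them, P + P = -P being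
    -- the flex condition, and this controls all powers of P by induction.
    data Multiple : Point → Set (c ⊔ ℓ₁) where
      infinity : Multiple nothing
      positive : ∀ {x′ y′} → x′ ≈ x → y′ ≈ y → Multiple (just (x′ , y′))
      negative : ∀ {x′ y′} → x′ ≈ x → y′ ≈ - y - a₁ * x - a₃ → Multiple (just (x′ , y′))

    add-multiple : ∀ {Q} → Multiple Q → Multiple (add E (just (x , y)) Q)
    add-multiple infinity = positive refl refl
    add-multiple (positive x′≈x y′≈y) = ≡.subst Multiple
      (≡.sym (add-tangent (sym x′≈x) λ eq → denominator≉0
        (trans (sym (y+y≈2y x y)) (trans (sym (+-congʳ (+-cong (+-congˡ y′≈y) (*-congˡ x′≈x)))) eq))))
      (negative (tangent-third x′≈x) (chord-ordinate (tangent-third x′≈x)))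
    add-multiple (negative x′≈x y′≈-y) =
      ≡.subst Multiple (≡.sym (add-vertical (sym x′≈x) (opposite x′≈x y′≈-y))) infinity

    private
      twice≉0 : ¬ (y + y + a₁ * x + a₃ ≈ 0#)
      twice≉0 eq = denominator≉0 (trans (sym (y+y≈2y x y)) eq)

    Flex⇒Torsion : Torsion E 3 (just (x , y))
    Flex⇒Torsion = just onCurve , ≡.subst (λ Q → add E (just (x , y)) Q ≈ₚ nothing)
      (≡.sym (add-tangent refl twice≉0))
      (≡.subst (_≈ₚ nothing) (≡.sym (add-vertical (sym x₃≈x) (opposite x₃≈x (chord-ordinate x₃≈x)))) nothing)
      where
      x₃≈x : third-abscissa (tangent x y) x x ≈ x
      x₃≈x = tangent-third refl

    Abscissa : Pred Point (c ⊔ ℓ₁)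
    Abscissa = All λ (x′ , _) → x′ ≈ x

    Multiple⇒Abscissa : ∀ {Q} → Multiple Q → Abscissa Q
    Multiple⇒Abscissa infinity            = nothing
    Multiple⇒Abscissa (positive x′≈x _)   = just x′≈x
    Multiple⇒Abscissa (negative x′≈x _)   = just x′≈x

    multiple : ∀ n → Multiple (power G (+ n) (just (x , y)))
    multiple zero    = infinity
    multiple (suc n) = add-multiple (multiple n)

    power-abscissa : ∀ k → Abscissa (power G k (just (x , y)))
    power-abscissa (+ n)      = Multiple⇒Abscissa (multiple n)
    power-abscissa (-[1+ n ]) = negate-abscissa (Multiple⇒Abscissa (multiple (suc n)))
      where
      negate-abscissa : ∀ {Q} → Abscissa Q → Abscissa (negate E Q)
      negate-abscissa nothing     = nothing
      negate-abscissa (just x′≈x) = just x′≈x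

  -- Otherwise 3P is finite: it is P itself if 2P is at infinity, and lies on a chord through
  -- distinct abscissas if the tangent meets the curve elsewhere.
  Torsion⇒Flex : ∀ {x y} → Torsion E 3 (just (x , y)) → Flex x y
  Torsion⇒Flex {x} {y} (just onCurve , 3P≈0) with y + y + a₁ * x + a₃ ≟ 0#
  ... | yes twice≈0 = contradiction
    (≡.subst (λ Q → add E (just (x , y)) Q ≈ₚ nothing) (add-vertical refl twice≈0) 3P≈0) λ ()
  ... | no  twice≉0 with x ≟ third-abscissa (tangent x y) x x
  ...   | yes x≈x₃ = record
    { onCurve       = onCurve
    ; denominator≉0 = d≉0
    ; slope         = tangent x y
    ; slope-eq      = modulo₁ (*-inverseʳ d≉0) (solve 3 (λ n d e →
        n :* e :* d := n :+ n :* (d :* e :- con (+ 1)))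
        (tangent-numerator x y) (tangent-denominator x y) (tangent-denominator x y ⁻¹))
    ; third         = sym x≈x₃
    }
    where
    d≉0 : ¬ (tangent-denominator x y ≈ 0#)
    d≉0 eq = twice≉0 (trans (y+y≈2y x y) eq)
  ...   | no  x≉x₃ = contradiction
    (≡.subst (_≈ₚ nothing) (proj₂ (add-distinct x≉x₃))
      (≡.subst (λ Q → add E (just (x , y)) Q ≈ₚ nothing) (add-tangent refl twice≉0) 3P≈0)) λ ()

  -- A finite generator is itself a flex, so all its finite multiples share its abscissa; the point
  -- at infinity generates nothing finite.
  distinct⇒¬Cyclic : ∀ {x₁ y₁ x₂ y₂} → Flex x₁ y₁ → Flex x₂ y₂ → ¬ (x₁ ≈ x₂) → ¬ Cyclic G (Torsion E 3)
  distinct⇒¬Cyclic P Q x₁≉x₂ (nothing , _ , generates) =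
    let k , eq = generates _ (Flex⇒Torsion P) in infinity-generates k eq
    where
    multiple-infinity : ∀ n → power G (+ n) nothing ≡ nothing
    multiple-infinity zero    = ≡.refl
    multiple-infinity (suc n) = multiple-infinity n

    infinity-generates : ∀ k {P} → ¬ (power G k nothing ≈ₚ just P)
    infinity-generates (+ n)      eq = contradiction (≡.subst (_≈ₚ _) (multiple-infinity n) eq) λ ()
    infinity-generates (-[1+ n ]) eq =
      contradiction (≡.subst (λ Q → negate E Q ≈ₚ _) (multiple-infinity n) eq) λ ()
  distinct⇒¬Cyclic P Q x₁≉x₂ (just (x , y) , torsion , generates) =
    x₁≉x₂ (trans (abscissa P) (sym (abscissa Q)))
    where
    R : Flex x y
    R = Torsion⇒Flex torsion

    abscissa-resp : ∀ {S x′ y′} → Abscissa R S → S ≈ₚ just (x′ , y′) → x′ ≈ x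
    abscissa-resp (just eq) (just (eq′ , _)) = trans (sym eq′) eq

    abscissa : ∀ {x′ y′} → Flex x′ y′ → x′ ≈ x
    abscissa S = let k , eq = generates _ (Flex⇒Torsion S) in abscissa-resp (power-abscissa R k) eq

  -- Points of the curve with a common abscissa are equal or opposite, so the exponents 0, 1 and -1
  -- reach everything.
  single⇒Cyclic : ∀ {x₁ y₁} → Flex x₁ y₁ → (∀ {x y} → Flex x y → x ≈ x₁) → Cyclic G (Torsion E 3)
  single⇒Cyclic {x₁} {y₁} P single = just (x₁ , y₁) , Flex⇒Torsion P , generates
    where
    generates : ∀ Q → Torsion E 3 Q → ∃ λ k → power G k (just (x₁ , y₁)) ≈ₚ Q
    generates nothing        _       = + 0 , nothing
    generates (just (x , y)) torsion = Sum.[ (λ eq → + 1 , just (sym x≈x₁ , sym (y≈y₁ eq)))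
                                           , (λ eq → -[1+ 0 ] , just (sym x≈x₁ , sym (y≈-y₁ eq))) ]′
      (zero-product product≈0)
      where
      Q : Flex x y
      Q = Torsion⇒Flex torsion

      x≈x₁ : x ≈ x₁
      x≈x₁ = single Q

      product≈0 : (y - y₁) * (y + y₁ + a₁ * x₁ + a₃) ≈ 0#
      product≈0 = modulo₃ (Flex.onCurve Q) (Flex.onCurve P) x≈x₁ (solve 9 (λ a₁ a₂ a₃ a₄ a₆ x₁ y₁ x y →
        (y :- y₁) :* (y :+ y₁ :+ a₁ :* x₁ :+ a₃) := con (+ 0)
        :+ con (+ 1) :* (y :^ 2 :+ a₁ :* x :* y :+ a₃ :* y :- (x :^ 3 :+ a₂ :* x :^ 2 :+ a₄ :* x :+ a₆))
        :+ :- con (+ 1) :* (y₁ :^ 2 :+ a₁ :* x₁ :* y₁ :+ a₃ :* y₁ :- (x₁ :^ 3 :+ a₂ :* x₁ :^ 2 :+ a₄ :* x₁ :+ a₆))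
        :+ (x :^ 2 :+ x :* x₁ :+ x₁ :^ 2 :+ a₂ :* (x :+ x₁) :+ a₄ :- a₁ :* y) :* (x :- x₁))
        a₁ a₂ a₃ a₄ a₆ x₁ y₁ x y)

      y≈y₁ : y - y₁ ≈ 0# → y ≈ y₁
      y≈y₁ eq = modulo₁ eq (solve 2 (λ y y₁ → y := y₁ :+ con (+ 1) :* (y :- y₁ :- con (+ 0))) y y₁)

      y≈-y₁ : y + y₁ + a₁ * x₁ + a₃ ≈ 0# → y ≈ - y₁ - a₁ * x₁ - a₃
      y≈-y₁ eq = modulo₁ eq (solve 5 (λ a₁ a₃ x₁ y₁ y → y := :- y₁ :- a₁ :* x₁ :- a₃ :+
        con (+ 1) :* (y :+ y₁ :+ a₁ :* x₁ :+ a₃ :- con (+ 0))) a₁ a₃ x₁ y₁ y)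

  none⇒Cyclic : (∀ {x y} → ¬ Flex x y) → Cyclic G (Torsion E 3)
  none⇒Cyclic none = nothing , (nothing , nothing) , λ
    { nothing  _       → + 0 , nothing
    ; (just _) torsion → contradiction (Torsion⇒Flex torsion) none
    }

  -- The negative hypothesis yields actual points because the coordinates can be searched: a failed
  -- search shows the torsion to be cyclic.
  ¬Cyclic⇒distinct : ¬ Cyclic G (Torsion E 3) →
    ∃ λ x₁ → ∃ λ y₁ → ∃ λ x₂ → ∃ λ y₂ → Flex x₁ y₁ × Flex x₂ y₂ × ¬ (x₁ ≈ x₂)
  ¬Cyclic⇒distinct ¬cyclic
    with any? (λ x → any? (Flex? x) (Flex-resp refl)) (λ x≈x′ (y , P) → y , Flex-resp x≈x′ refl P)
  ... | no none = contradiction (none⇒Cyclic λ P → none (_ , _ , P)) ¬cyclic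
  ... | yes (x₁ , y₁ , P)
    with any? (λ x → any? (λ y → Flex? x y ×-dec ¬? (x₁ ≟ x)) (λ y≈y′ (Q , x₁≉x) → Flex-resp refl y≈y′ Q , x₁≉x))
      (λ x≈x′ (y , Q , x₁≉x) → y , Flex-resp x≈x′ refl Q , λ x₁≈x′ → x₁≉x (trans x₁≈x′ (sym x≈x′)))
  ...   | yes (x₂ , y₂ , Q , x₁≉x₂) = x₁ , y₁ , x₂ , y₂ , P , Q , x₁≉x₂
  ...   | no single = contradiction (single⇒Cyclic P only) ¬cyclic
    where
    only : ∀ {x y} → Flex x y → x ≈ x₁
    only {x} {y} Q with x₁ ≟ x
    ... | yes x₁≈x = sym x₁≈x
    ... | no  x₁≉x = contradiction (x , y , Q , x₁≉x) single

-- Non-cyclic 3-torsion and the Hesse form.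

module HesseForm (F : FiniteField c ℓ₁ ℓ₂) (ρ : PrimitiveCubeRoot F) where

  open FiniteField F hiding (zero)
  open FieldProperties F
  open EllipticCurves F
  open Isomorphisms F
  open IsomorphismRelation F
  open PrimitiveCubeRoot ρ
  open CubeRootsOfUnity F ρ
  open HessePencil F ρ

  -- For α = 3l and β = l³ - 1 the number α³ - 27β is 27, and the flexes besides the origin have
  -- abscissas -(l³ - 1)/(l - ζ). The choice ζ = 1 gives -L, nonzero because L divides l³ - 1.
  hesse-¬Cyclic : ∀ l l³≉1 → ¬ Cyclic (rawGroup (hesse l l³≉1)) (Torsion (hesse l l³≉1) 3)
  hesse-¬Cyclic l l³≉1 = distinct⇒¬Cyclic origin other 0≉x
    where
    open ThreeTorsion F (hesse l l³≉1)

    L : Carrier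
    L = l ^ 2 + l + 1#

    L≉0 : ¬ (L ≈ 0#)
    L≉0 L≈0 = l³≉1 (modulo₁ L≈0 (solve 1 (λ l →
      l :^ 3 := con (+ 1) :+ (l :- con (+ 1)) :* (l :^ 2 :+ l :+ con (+ 1) :- con (+ 0))) l))

    0≉x : ¬ (0# ≈ - L)
    0≉x 0≈x = L≉0 (modulo₁ 0≈x (solve 1 (λ L → L := con (+ 0) :+ con (+ 1) :* (con (+ 0) :- :- L)) L))

    origin : Flex 0# 0#
    origin = record
      { onCurve       = solve 1 (λ l → let o = con (+ 0) in
          o :^ 2 :+ 3 :× l :* o :* o :+ (l :^ 3 :- con (+ 1)) :* o := o :^ 3 :+ o :* o :^ 2 :+ o :* o :+ o) l
      ; denominator≉0 = λ eq → l³-1≉0 l³≉1 (trans (solve 1 (λ l → let o = con (+ 0) in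
          l :^ 3 :- con (+ 1) := 2 :× o :+ 3 :× l :* o :+ (l :^ 3 :- con (+ 1))) l) eq)
      ; slope         = 0#
      ; slope-eq      = solve 1 (λ l → let o = con (+ 0) in
          o :* (2 :× o :+ 3 :× l :* o :+ (l :^ 3 :- con (+ 1))) :=
          3 :× o :^ 2 :+ 2 :× (o :* o) :+ o :- 3 :× l :* o) l
      ; third         = solve 1 (λ l → let o = con (+ 0) in
          o :^ 2 :+ 3 :× l :* o :- o :- o :- o := o) l
      }

    other : Flex (- L) (L * (l + 1# + ω))
    other = record
      { onCurve       = modulo₁ ω²+ω+1≈0 (solve 2 (λ l ω → let
            o = con (+ 0)
            L = l :^ 2 :+ l :+ con (+ 1)
            x = :- L
            y = L :* (l :+ con (+ 1) :+ ω)
          in y :^ 2 :+ 3 :× l :* x :* y :+ (l :^ 3 :- con (+ 1)) :* y :=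
            x :^ 3 :+ o :* x :^ 2 :+ o :* x :+ o :+ L :^ 2 :* (ω :^ 2 :+ ω :+ con (+ 1) :- o)) l ω)
      ; denominator≉0 = λ eq → ≉0-* L≉0 θ≉0 (trans (solve 2 (λ l ω → let
            L = l :^ 2 :+ l :+ con (+ 1)
            x = :- L
            y = L :* (l :+ con (+ 1) :+ ω)
          in L :* (2 :× ω :+ con (+ 1)) := 2 :× y :+ 3 :× l :* x :+ (l :^ 3 :- con (+ 1))) l ω) eq)
      ; slope         = - (2 · ω + 1#) * (1# - ω * l)
      ; slope-eq      = modulo₁ ω²+ω+1≈0 (solve 2 (λ l ω → let
            o = con (+ 0)
            L = l :^ 2 :+ l :+ con (+ 1)
            x = :- L
            y = L :* (l :+ con (+ 1) :+ ω)
            m = :- (2 :× ω :+ con (+ 1)) :* (con (+ 1) :- ω :* l)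
          in m :* (2 :× y :+ 3 :× l :* x :+ (l :^ 3 :- con (+ 1))) :=
            3 :× x :^ 2 :+ 2 :× (o :* x) :+ o :- 3 :× l :* y
            :+ 4 :× (L :* (l :* ω :- con (+ 1))) :* (ω :^ 2 :+ ω :+ con (+ 1) :- o)) l ω)
      ; third         = modulo₁ ω²+ω+1≈0 (solve 2 (λ l ω → let
            o = con (+ 0)
            x = :- (l :^ 2 :+ l :+ con (+ 1))
            m = :- (2 :× ω :+ con (+ 1)) :* (con (+ 1) :- ω :* l)
          in m :^ 2 :+ 3 :× l :* m :- o :- x :- x := x
            :+ (4 :× (l :^ 2 :* ω :^ 2) :- 8 :× (l :* ω) :+ 3 :× l :^ 2 :+ con (+ 4))
               :* (ω :^ 2 :+ ω :+ con (+ 1) :- o)) l ω)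
      }

  -- On y² + αxy + βy = x³ the abscissa X of a flex other than (0 , 0) satisfies
  -- (αX + 3β)³ = (α³ - 27β)X³, so that α³ - 27β is a cube.
  flex-abscissa : ∀ {α β X Y M} → ¬ (X ≈ 0#) →
    Y ^ 2 + α * X * Y + β * Y ≈ X ^ 3 →
    M * (2 · Y + α * X + β) ≈ 3 · X ^ 2 - α * Y →
    M ^ 2 + α * M ≈ 3 · X →
    3 · X ^ 3 + α ^ 2 * X ^ 2 + 3 · (α * β * X) + 3 · β ^ 2 ≈ 0#
  flex-abscissa {α} {β} {X} {Y} {M} X≉0 curve slope third = cancel X≉0 (modulo₃ curve slope third
    (solve 5 (λ α β X Y M → let
        D = 2 :× Y :+ α :* X :+ β
        N = 3 :× X :^ 2 :- α :* Y
      in X :* (3 :× X :^ 3 :+ α :^ 2 :* X :^ 2 :+ 3 :× (α :* β :* X) :+ 3 :× β :^ 2) := con (+ 0)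
        :+ (:- (α :^ 2) :- 12 :× X) :* (Y :^ 2 :+ α :* X :* Y :+ β :* Y :- X :^ 3)
        :+ (M :* D :+ N :+ α :* D) :* (M :* D :- N)
        :+ (:- (D :^ 2)) :* (M :^ 2 :+ α :* M :- 3 :× X)) α β X Y M))

  -- (αX + 3β)³ - (α³ - 27β)X³ is 9β times the vanishing cubic; division by X³ gives the cube root α
  -- + 3β/X.
  cube-from-flex : ∀ {α β X} → ¬ (X ≈ 0#) →
    3 · X ^ 3 + α ^ 2 * X ^ 2 + 3 · (α * β * X) + 3 · β ^ 2 ≈ 0# → ∃ λ w → w ^ 3 ≈ α ^ 3 - 27 · β
  cube-from-flex {α} {β} {X} X≉0 ψ≈0 = (α * X + 3 · β) * X ⁻¹ , modulo₂ ψ≈0 (*-inverseʳ X≉0)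
    (solve 4 (λ α β X ξ → ((α :* X :+ 3 :× β) :* ξ) :^ 3 := α :^ 3 :- 27 :× β
      :+ 9 :× (β :* ξ :^ 3) :* (3 :× X :^ 3 :+ α :^ 2 :* X :^ 2 :+ 3 :× (α :* β :* X) :+ 3 :× β :^ 2 :- con (+ 0))
      :+ (α :^ 3 :- 27 :× β) :* ((X :* ξ) :^ 2 :+ X :* ξ :+ con (+ 1)) :* (X :* ξ :- con (+ 1)))
      α β X (X ⁻¹))

  module _ (E : EllipticCurve) where

    open EllipticCurve E
    open ThreeTorsion F E

    module TwoFlexes {x₁ y₁ x₂ y₂} (P : Flex x₁ y₁) (Q : Flex x₂ y₂) (x₁≉x₂ : ¬ (x₁ ≈ x₂)) where

      module P = Flex P
      module Q = Flex Q

      -- The coefficients once the first flex is at the origin with tangent y = 0, followed by the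
      -- coordinates of the second flex and the slope of its tangent there.
      α β X Y M : Carrier
      α = a₁ + 2 · P.slope
      β = a₃ + x₁ * a₁ + 2 · y₁
      X = x₂ - x₁
      Y = y₂ - y₁ - P.slope * (x₂ - x₁)
      M = Q.slope - P.slope

      flexForm : WeierstrassEquation
      flexForm = record { a₁ = α ; a₂ = 0# ; a₃ = β ; a₄ = 0# ; a₆ = 0# }

      β≉0 : ¬ (β ≈ 0#)
      β≉0 β≈0 = P.denominator≉0 (trans (solve 4 (λ a₁ a₃ x y →
        2 :× y :+ a₁ :* x :+ a₃ := a₃ :+ x :* a₁ :+ 2 :× y) a₁ a₃ x₁ y₁) β≈0)

      X≉0 : ¬ (X ≈ 0#)
      X≉0 X≈0 = x₁≉x₂ (modulo₁ X≈0 (solve 2 (λ x₁ x₂ →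
        x₁ := x₂ :+ :- con (+ 1) :* (x₂ :- x₁ :- con (+ 0))) x₁ x₂))

      -- The vanishing of a₂, a₄ and a₆ is, in this order, the triple contact, the tangency and the
      -- incidence in the definition of a flex.
      transform≈flexForm : transform x₁ P.slope y₁ equation ≈ʷ flexForm
      transform≈flexForm =
          refl
        ∷ modulo₁ P.third (solve 4 (λ a₁ a₂ x m →
            a₂ :- m :* a₁ :+ 3 :× x :- m :^ 2 := con (+ 0) :+
            :- con (+ 1) :* (m :^ 2 :+ a₁ :* m :- a₂ :- x :- x :- x)) a₁ a₂ x₁ P.slope)
        ∷ refl
        ∷ modulo₁ P.slope-eq (solve 7 (λ a₁ a₂ a₃ a₄ x y m →
            a₄ :- m :* a₃ :+ 2 :× (x :* a₂) :- (y :+ x :* m) :* a₁ :+ 3 :× x :^ 2 :- 2 :× (m :* y) := con (+ 0) :+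
            :- con (+ 1) :* (m :* (2 :× y :+ a₁ :* x :+ a₃) :- (3 :× x :^ 2 :+ 2 :× (a₂ :* x) :+ a₄ :- a₁ :* y)))
            a₁ a₂ a₃ a₄ x₁ y₁ P.slope)
        ∷ modulo₁ P.onCurve (solve 7 (λ a₁ a₂ a₃ a₄ a₆ x y →
            a₆ :+ x :* a₄ :+ x :^ 2 :* a₂ :+ x :^ 3 :- y :* a₃ :- y :^ 2 :- x :* y :* a₁ := con (+ 0) :+
            :- con (+ 1) :* (y :^ 2 :+ a₁ :* x :* y :+ a₃ :* y :- (x :^ 3 :+ a₂ :* x :^ 2 :+ a₄ :* x :+ a₆)))
            a₁ a₂ a₃ a₄ a₆ x₁ y₁)
        ∷ []

      curve : Y ^ 2 + α * X * Y + β * Y ≈ X ^ 3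
      curve = modulo₄ Q.onCurve P.onCurve P.slope-eq P.third (solve 10 (λ a₁ a₂ a₃ a₄ a₆ x₁ y₁ m x₂ y₂ → let
          α = a₁ :+ 2 :× m
          β = a₃ :+ x₁ :* a₁ :+ 2 :× y₁
          X = x₂ :- x₁
          Y = y₂ :- y₁ :- m :* (x₂ :- x₁)
        in Y :^ 2 :+ α :* X :* Y :+ β :* Y := X :^ 3
          :+ con (+ 1) :* (y₂ :^ 2 :+ a₁ :* x₂ :* y₂ :+ a₃ :* y₂ :- (x₂ :^ 3 :+ a₂ :* x₂ :^ 2 :+ a₄ :* x₂ :+ a₆))
          :+ :- con (+ 1) :* (y₁ :^ 2 :+ a₁ :* x₁ :* y₁ :+ a₃ :* y₁ :- (x₁ :^ 3 :+ a₂ :* x₁ :^ 2 :+ a₄ :* x₁ :+ a₆))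
          :+ (:- X) :* (m :* (2 :× y₁ :+ a₁ :* x₁ :+ a₃) :- (3 :× x₁ :^ 2 :+ 2 :× (a₂ :* x₁) :+ a₄ :- a₁ :* y₁))
          :+ (:- (X :^ 2)) :* (m :^ 2 :+ a₁ :* m :- a₂ :- x₁ :- x₁ :- x₁))
        a₁ a₂ a₃ a₄ a₆ x₁ y₁ P.slope x₂ y₂)

      slope : M * (2 · Y + α * X + β) ≈ 3 · X ^ 2 - α * Y
      slope = modulo₃ Q.slope-eq P.slope-eq P.third (solve 10 (λ a₁ a₂ a₃ a₄ x₁ y₁ m x₂ y₂ n → let
          α = a₁ :+ 2 :× m
          β = a₃ :+ x₁ :* a₁ :+ 2 :× y₁
          X = x₂ :- x₁
          Y = y₂ :- y₁ :- m :* (x₂ :- x₁)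
        in (n :- m) :* (2 :× Y :+ α :* X :+ β) := 3 :× X :^ 2 :- α :* Y
          :+ con (+ 1) :* (n :* (2 :× y₂ :+ a₁ :* x₂ :+ a₃) :- (3 :× x₂ :^ 2 :+ 2 :× (a₂ :* x₂) :+ a₄ :- a₁ :* y₂))
          :+ :- con (+ 1) :* (m :* (2 :× y₁ :+ a₁ :* x₁ :+ a₃) :- (3 :× x₁ :^ 2 :+ 2 :× (a₂ :* x₁) :+ a₄ :- a₁ :* y₁))
          :+ (:- (2 :× X)) :* (m :^ 2 :+ a₁ :* m :- a₂ :- x₁ :- x₁ :- x₁))
        a₁ a₂ a₃ a₄ x₁ y₁ P.slope x₂ y₂ Q.slope)

      third : M ^ 2 + α * M ≈ 3 · X
      third = modulo₂ Q.third P.third (solve 6 (λ a₁ a₂ x₁ m x₂ n →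
        (n :- m) :^ 2 :+ (a₁ :+ 2 :× m) :* (n :- m) := 3 :× (x₂ :- x₁)
          :+ con (+ 1) :* (n :^ 2 :+ a₁ :* n :- a₂ :- x₂ :- x₂ :- x₂)
          :+ :- con (+ 1) :* (m :^ 2 :+ a₁ :* m :- a₂ :- x₁ :- x₁ :- x₁)) a₁ a₂ x₁ P.slope x₂ Q.slope)

      flexForm-Δ : WeierstrassEquation.Δ flexForm ≈ β ^ 3 * (α ^ 3 - 27 · β)
      flexForm-Δ = solve 2 (λ α β → let
          o = con (+ 0)
          B₂ = α :^ 2 :+ 4 :× o
          B₄ = 2 :× o :+ α :* β
          B₆ = β :^ 2 :+ 4 :× o
          B₈ = α :^ 2 :* o :+ 4 :× (o :* o) :- α :* β :* o :+ o :* β :^ 2 :- o :^ 2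
        in :- (B₂ :^ 2 :* B₈) :- 8 :× B₄ :^ 3 :- 27 :× B₆ :^ 2 :+ 9 :× (B₂ :* B₄ :* B₆) :=
          β :^ 3 :* (α :^ 3 :- 27 :× β)) α β

      α³-27β≉0 : ¬ (α ^ 3 - 27 · β ≈ 0#)
      α³-27β≉0 eq = nonsingular (trans (sym (Δ-transform x₁ P.slope y₁ equation))
        (trans (Δ-cong transform≈flexForm) (trans flexForm-Δ (trans (*-congˡ eq) (zeroʳ _)))))

      cube-root : ∃ λ w → w ^ 3 ≈ α ^ 3 - 27 · β
      cube-root = cube-from-flex X≉0 (flex-abscissa X≉0 curve slope third)

      isomorphic : ∀ w → w ^ 3 ≈ α ^ 3 - 27 · β → ∃ λ l → Σ (¬ (l ^ 3 ≈ 1#)) λ l³≉1 → E ≅ hesse l l³≉1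
      isomorphic w w³≈ = l , l³≉1 , ≈ʷ⇒≅ (w * ⅓) x₁ P.slope y₁
        (≉0-* w≉0 λ ⅓≈0 → 1≉0 (trans (sym 3*⅓≈1) (trans (*-congˡ ⅓≈0) (zeroʳ _))))
        (≈ʷ-trans scale≈flexForm (≈ʷ-sym transform≈flexForm))
        where
        w≉0 : ¬ (w ≈ 0#)
        w≉0 w≈0 = α³-27β≉0 (trans (sym w³≈) (trans (*-congʳ w≈0) (zeroˡ _)))

        l : Carrier
        l = α * w ⁻¹

        wv≈1 : w * w ⁻¹ ≈ 1#
        wv≈1 = *-inverseʳ w≉0

        -- As wl = α, the left side is (α³ - w³)/27. That β is nonzero then excludes l³ = 1.
        third-coefficient : (w * ⅓) ^ 3 * (l ^ 3 - 1#) ≈ β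
        third-coefficient = modulo₃ wv≈1 w³≈ 3*⅓≈1 (solve 5 (λ α β w v t →
          (w :* t) :^ 3 :* ((α :* v) :^ 3 :- con (+ 1)) := β
          :+ (t :^ 3 :* α :^ 3 :* ((w :* v) :^ 2 :+ w :* v :+ con (+ 1))) :* (w :* v :- con (+ 1))
          :+ (:- (t :^ 3)) :* (w :^ 3 :- (α :^ 3 :- 27 :× β))
          :+ β :* (9 :× t :^ 2 :+ 3 :× t :+ con (+ 1)) :* (3 :× con (+ 1) :* t :- con (+ 1)))
          α β w (w ⁻¹) ⅓)

        l³≉1 : ¬ (l ^ 3 ≈ 1#)
        l³≉1 l³≈1 = β≉0 (trans (sym third-coefficient)
          (trans (*-congˡ (trans (+-congʳ l³≈1) (-‿inverseʳ 1#))) (zeroʳ _)))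

        scale≈flexForm : scale (w * ⅓) (hesseEquation l) ≈ʷ flexForm
        scale≈flexForm =
            modulo₂ wv≈1 3*⅓≈1 (solve 4 (λ α w v t → w :* t :* 3 :× (α :* v) := α
              :+ 3 :× (t :* α) :* (w :* v :- con (+ 1)) :+ α :* (3 :× con (+ 1) :* t :- con (+ 1))) α w (w ⁻¹) ⅓)
          ∷ zeroʳ _
          ∷ third-coefficient
          ∷ zeroʳ _
          ∷ zeroʳ _
          ∷ []

    hesse-form : ¬ Cyclic G (Torsion E 3) → ∃ λ l → Σ (¬ (l ^ 3 ≈ 1#)) λ l³≉1 → E ≅ hesse l l³≉1
    hesse-form ¬cyclic =
      let x₁ , y₁ , x₂ , y₂ , P , Q , x₁≉x₂ = ¬Cyclic⇒distinct ¬cyclic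
          open TwoFlexes P Q x₁≉x₂
          w , w³≈ = cube-root
      in isomorphic w w³≈

-- Counting the nonzero values of v³.

module ValueCount (F : FiniteField c ℓ₁ ℓ₂) (ρ : PrimitiveCubeRoot F) where

  open FiniteField F hiding (zero)
  open FieldProperties F
  open CubeRootsOfUnity F ρ

  cube-cong : ∀ {x y} → x ≈ y → x ^ 3 ≈ y ^ 3
  cube-cong x≈y = congruence 1 (λ x → x :^ 3) (x≈y ∷ [])

  cube-zero : ∀ {x} → x ^ 3 ≈ 0# → x ≈ 0#
  cube-zero {x} eq = Sum.[ (λ x≈0 → x≈0) , square-zero ]′ (zero-product eq)

  Value : Pred Carrier _
  Value j = ¬ (j ≈ 0#) × ∃ λ l → ∃ λ v → Quartic l v × v ^ 3 ≈ j

  Value-resp : ∀ {j j′} → j ≈ j′ → Value j → Value j′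
  Value-resp j≈j′ (j≉0 , l , v , Q , v³≈j) = (λ j′≈0 → j≉0 (trans j≈j′ j′≈0)) , l , v , Q , trans v³≈j j≈j′

  Value? : ∀ j → Dec (Value j)
  Value? j = ¬? (j ≟ 0#) ×-dec
    any? (λ l → any? (λ v → Quartic? l v ×-dec (v ^ 3 ≟ j))
        (λ v≈v′ (Q , v³≈j) → Quartic-resp refl v≈v′ Q , trans (sym (cube-cong v≈v′)) v³≈j))
      (λ l≈l′ (v , Q , v³≈j) → v , Quartic-resp l≈l′ refl Q , v³≈j)

  open Enumeration (enumerate (λ i → Value? (from i)))
    using (satisfies; complete) renaming (element to valueIndex; injective to valueIndex-injective)

  -- Up to the factor 27 the values v³ are j-invariants; j = 0 is left out here.
  size : ℕ
  size = Enumeration.size (enumerate (λ i → Value? (from i)))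

  value : Fin size → Carrier
  value c = from (valueIndex c)

  value≉0 : ∀ c → ¬ (value c ≈ 0#)
  value≉0 c = proj₁ (satisfies c)

  module Representative (c : Fin size) where
    l v : Carrier
    l = proj₁ (proj₂ (satisfies c))
    v = proj₁ (proj₂ (proj₂ (satisfies c)))

    quartic : Quartic l v
    quartic = proj₁ (proj₂ (proj₂ (proj₂ (satisfies c))))

    v³≈value : v ^ 3 ≈ value c
    v³≈value = proj₂ (proj₂ (proj₂ (proj₂ (satisfies c))))

    v≉0 : ¬ (v ≈ 0#)
    v≉0 v≈0 = value≉0 c (trans (sym v³≈value) (trans (*-congʳ v≈0) (zeroˡ _)))

  value-complete : ∀ {l v} → Quartic l v → ¬ (v ≈ 0#) → ∃ λ c → value c ≈ v ^ 3
  value-complete {l} {v} Q v≉0 =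
    let c , eq = complete (Value-resp (sym (from-to (v ^ 3))) ((λ eq → v≉0 (cube-zero eq)) , l , v , Q , refl))
    in c , trans (reflexive (≡.cong from eq)) (from-to (v ^ 3))

  value-injective : ∀ {c c′} → value c ≈ value c′ → c ≡ c′
  value-injective eq = valueIndex-injective (from-injective eq)

  -- Index `zero` is the class v = 0, represented by l = 0; it accounts for the successor in the
  -- final count.
  Class : Carrier → Fin (suc size) → Set ℓ₁
  Class v zero    = v ≈ 0#
  Class v (suc c) = value c ≈ v ^ 3

  Class-total : ∀ {l v} → Quartic l v → ∃ (Class v)
  Class-total {v = v} Q with v ≟ 0#
  ... | yes v≈0 = zero , v≈0
  ... | no  v≉0 = Product.map suc (λ eq → eq) (value-complete Q v≉0)

  Class-functional : ∀ {v v′} k k′ → Class v k → Class v′ k′ → v ^ 3 ≈ v′ ^ 3 → k ≡ k′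
  Class-functional zero    zero     _   _    _  = ≡.refl
  Class-functional zero    (suc c′) v≈0 eq′  eq =
    contradiction (trans eq′ (trans (sym eq) (trans (*-congʳ v≈0) (zeroˡ _)))) (value≉0 c′)
  Class-functional (suc c) zero     eq′ v′≈0 eq =
    contradiction (trans eq′ (trans eq (trans (*-congʳ v′≈0) (zeroˡ _)))) (value≉0 c)
  Class-functional (suc c) (suc c′) eq₁ eq₂  eq =
    ≡.cong suc (value-injective (trans eq₁ (trans eq (sym eq₂))))

  Class-injective : ∀ {v v′} k → Class v k → Class v′ k → v ^ 3 ≈ v′ ^ 3
  Class-injective zero    v≈0 v′≈0 = cube-cong (trans v≈0 (sym v′≈0))
  Class-injective (suc c) eq  eq′  = trans (sym eq) eq′

  Class-surjective : ∀ k → ∃ λ l → ∃ λ v → Quartic l v × Class v k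
  Class-surjective zero    = 0# , 0# ,
    solve 0 (let o = con (+ 0) in o :* (o :^ 3 :+ 8 :× con (+ 1)) := o :* (o :^ 3 :- con (+ 1))) , refl
  Class-surjective (suc c) = l , v , quartic , sym v³≈value
    where open Representative c

  orbit : Fin 4 → Carrier → Carrier
  orbit zero    l = l
  orbit (suc k) l = ζ k * (l + 2 · ζ k) * (l - ζ k) ⁻¹

  orbit-exchange : ∀ k {l} → ¬ (l ^ 3 ≈ 1#) → Exchange (ζ k) l (orbit (suc k) l)
  orbit-exchange k {l} l³≉1 = modulo₁ (*-inverseʳ (l-z≉0 (ζ³≈1 k) l³≉1)) (solve 3 (λ n d e →
    n :* e :* d := n :+ n :* (d :* e :- con (+ 1))) (ζ k * (l + 2 · ζ k)) (l - ζ k) ((l - ζ k) ⁻¹))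

  Exchange⇒orbit : ∀ k {l m} → ¬ (l ^ 3 ≈ 1#) → Exchange (ζ k) l m → m ≈ orbit (suc k) l
  Exchange⇒orbit k {l} {m} l³≉1 ex = modulo₂ ex (*-inverseʳ (l-z≉0 (ζ³≈1 k) l³≉1)) (solve 4 (λ m n d e →
    m := n :* e :+ e :* (m :* d :- n) :+ (:- m) :* (d :* e :- con (+ 1)))
    m (ζ k * (l + 2 · ζ k)) (l - ζ k) ((l - ζ k) ⁻¹))

  fibre-orbit : ∀ {l m v} → Quartic l v → Quartic m v → ∃ λ k → m ≈ orbit k l
  fibre-orbit Ql Qm = Sum.[ (λ m≈l → zero , m≈l)
    , (λ (k , ex) → suc k , Exchange⇒orbit k (Quartic⇒l³≉1 Ql) ex) ]′ (Quartic-fibre Ql Qm)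

  -2# : Carrier
  -2# = - (2 · 1#)

  root-of-zero : ∀ {x v} → Quartic x v → v ≈ 0# → x ≈ 0# ⊎ x ^ 3 ≈ -2# ^ 3
  root-of-zero {x} {v} Q v≈0 = Sum.map₂
    (λ eq → modulo₁ eq (solve 1 (λ x → x :^ 3 := (:- (2 :× con (+ 1))) :^ 3 :+
      con (+ 1) :* (x :^ 3 :+ 8 :× con (+ 1) :- con (+ 0))) x))
    (zero-product (trans Q (trans (*-congʳ v≈0) (zeroˡ _))))

  -- A rotation gives v the right cube root and `orbit` runs through its fibre. Seven is 0 together
  -- with the three ζ and the three -2ζ. Repetitions, as over j = 1728 or among the -2ζ in
  -- characteristic 2, do not harm an upper bound.
  order≤ : order ℕ.≤ size ℕ.* 12 ℕ.+ 7
  order≤ = surjection⇒≤-*+ (λ c k → to (generic c (Fin.remQuot 4 k))) (λ k → to (remaining k))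
    (λ x → Sum.map (λ (c , k , eq) → c , k , ≈⇒to≡ eq) (λ (k , eq) → k , ≈⇒to≡ eq) (covered (from x)))
    where
    generic : Fin size → Fin 3 × Fin 4 → Carrier
    generic c (i , k) = orbit k (ζ i * Representative.l c)

    exceptional : Fin 2 × Fin 3 → Carrier
    exceptional (zero     , i) = ζ i
    exceptional (suc zero , i) = ζ i * -2#

    remaining : Fin 7 → Carrier
    remaining zero    = 0#
    remaining (suc k) = exceptional (Fin.remQuot 3 k)

    ≈⇒to≡ : ∀ {x y} → y ≈ from x → to y ≡ x
    ≈⇒to≡ eq = from-injective (trans (from-to _) eq)

    Covered : Carrier → Set ℓ₁
    Covered x = (∃ λ c → ∃ λ k → generic c (Fin.remQuot 4 k) ≈ x) ⊎ (∃ λ k → remaining k ≈ x)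

    covered-value : ∀ {x v} → Quartic x v → ¬ (v ≈ 0#) → Covered x
    covered-value {x} {v} Q v≉0 =
      let c , value≈v³ = value-complete Q v≉0
          open Representative c using (quartic; v³≈value)
          i , v≈ζv = equal-cubes (sym (trans v³≈value value≈v³))
          k , x≈orbit = fibre-orbit (Quartic-rotate (ζ³≈1 i) quartic) (Quartic-resp refl v≈ζv Q)
      in inj₁ (c , Fin.combine i k ,
           trans (reflexive (≡.cong (generic c) (Fin.remQuot-combine i k))) (sym x≈orbit))

    covered-exceptional : ∀ s i {x} → x ≈ exceptional (s , i) → Covered x
    covered-exceptional s i eq = inj₂ (suc (Fin.combine s i) ,
      trans (reflexive (≡.cong exceptional (Fin.remQuot-combine s i))) (sym eq))

    covered-zero : ∀ {x} → x ≈ 0# ⊎ x ^ 3 ≈ -2# ^ 3 → Covered x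
    covered-zero (inj₁ x≈0) = inj₂ (zero , sym x≈0)
    covered-zero (inj₂ eq)  = let i , x≈ = equal-cubes eq in covered-exceptional (suc zero) i x≈

    covered : ∀ x → Covered x
    covered x with x ^ 3 ≟ 1#
    ... | yes x³≈1 = let i , x≈ζ = unit-cube x³≈1 in covered-exceptional zero i x≈ζ
    ... | no  x³≉1 = by-value (Quartic-value x³≉1)
      where
      by-value : ∃ (Quartic x) → Covered x
      by-value (v , Q) with v ≟ 0#
      ... | yes v≈0 = covered-zero (root-of-zero Q v≈0)
      ... | no  v≉0 = covered-value Q v≉0

  -- The relation l(l³ + 8) = v(l³ - 1), extended to the l with l³ = 1 or l³ = -8
  -- in such a way that the values v = 4ζ, which only two other l take, are taken
  -- by two more.
  Extended : (l v : Carrier) → Set ℓ₁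
  Extended l v = Quartic l v ⊎ (l ^ 3 ≈ 1# × v ≈ 4 · l) ⊎ (l ^ 3 ≈ -2# ^ 3 × v ≈ -2# * l)

  private
    unit≉eight : ∀ {l} → l ^ 3 ≈ 1# → ¬ (l ^ 3 ≈ -2# ^ 3)
    unit≉eight l³≈1 l³≈-8 = 9≉0 (modulo₂ l³≈1 l³≈-8 (solve 1 (λ l → 9 :× con (+ 1) := con (+ 0)
      :+ :- con (+ 1) :* (l :^ 3 :- con (+ 1)) :+ con (+ 1) :* (l :^ 3 :- (:- (2 :× con (+ 1))) :^ 3)) _))

    quartic≉eight : ∀ {l v} → ¬ (v ≈ 0#) → Quartic l v → ¬ (l ^ 3 ≈ -2# ^ 3)
    quartic≉eight {l} {v} v≉0 Q l³≈-8 = v≉0 (cancel 9≉0 (modulo₂ Q l³≈-8 (solve 2 (λ l v →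
      9 :× con (+ 1) :* v := con (+ 0)
      :+ con (+ 1) :* (l :* (l :^ 3 :+ 8 :× con (+ 1)) :- v :* (l :^ 3 :- con (+ 1)))
      :+ (v :- l) :* (l :^ 3 :- (:- (2 :× con (+ 1))) :^ 3)) l v)))

  -- The three clauses compete only at l³ = -8, where the quartic gives v = 0; nonzero values
  -- exclude this. The poles have no quartic value, and 1 and -8 differ by 9.
  Extended-functional : ∀ {l v v′} → ¬ (v ≈ 0#) → ¬ (v′ ≈ 0#) → Extended l v → Extended l v′ → v ≈ v′
  Extended-functional _ _ (inj₁ Q) (inj₁ Q′) = Quartic-functional Q Q′
  Extended-functional _ _ (inj₁ Q) (inj₂ (inj₁ (l³≈1 , _))) = contradiction l³≈1 (Quartic⇒l³≉1 Q)
  Extended-functional v≉0 _ (inj₁ Q) (inj₂ (inj₂ (l³≈-8 , _))) = contradiction l³≈-8 (quartic≉eight v≉0 Q)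
  Extended-functional _ _ (inj₂ (inj₁ (l³≈1 , _))) (inj₁ Q′) = contradiction l³≈1 (Quartic⇒l³≉1 Q′)
  Extended-functional _ _ (inj₂ (inj₁ (_ , eq))) (inj₂ (inj₁ (_ , eq′))) = trans eq (sym eq′)
  Extended-functional _ _ (inj₂ (inj₁ (l³≈1 , _))) (inj₂ (inj₂ (l³≈-8 , _))) = contradiction l³≈-8 (unit≉eight l³≈1)
  Extended-functional _ v′≉0 (inj₂ (inj₂ (l³≈-8 , _))) (inj₁ Q′) = contradiction l³≈-8 (quartic≉eight v′≉0 Q′)
  Extended-functional _ _ (inj₂ (inj₂ (l³≈-8 , _))) (inj₂ (inj₁ (l³≈1 , _))) = contradiction l³≈-8 (unit≉eight l³≈1)
  Extended-functional _ _ (inj₂ (inj₂ (_ , eq))) (inj₂ (inj₂ (_ , eq′))) = trans eq (sym eq′)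

  Extended-resp : ∀ {l l′ v} → l ≈ l′ → Extended l v → Extended l′ v
  Extended-resp l≈l′ = Sum.map (Quartic-resp l≈l′ refl) (Sum.map
    (λ (l³≈1 , eq) → trans (sym (cube-cong l≈l′)) l³≈1 , trans eq (congruence 1 (λ l → 4 :× l) (l≈l′ ∷ [])))
    (λ (l³≈-8 , eq) → trans (sym (cube-cong l≈l′)) l³≈-8 , trans eq (*-congˡ l≈l′)))

  Extended-rotate : ∀ {z l v} → z ^ 3 ≈ 1# → Extended l v → Extended (z * l) (z * v)
  Extended-rotate {z} {l} {v} z³≈1 = Sum.map (Quartic-rotate z³≈1) (Sum.map
    (λ (l³≈1 , eq) →
      trans rotated l³≈1 ,
      modulo₁ eq (solve 3 (λ z l v → z :* v := 4 :× (z :* l) :+ z :* (v :- 4 :× l)) z l v))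
    (λ (l³≈-8 , eq) →
      trans rotated l³≈-8 ,
      modulo₁ eq (solve 4 (λ z l v k → z :* v := k :* (z :* l) :+ z :* (v :- k :* l)) z l v -2#)))
    where
    rotated : (z * l) ^ 3 ≈ l ^ 3
    rotated = modulo₁ z³≈1 (solve 2 (λ z l → (z :* l) :^ 3 := l :^ 3 :+ l :^ 3 :* (z :^ 3 :- con (+ 1))) z l)

  -- Rotated by the cube roots of unity, the four points become the twelve parameters charged to
  -- `j`. The cube root `v` of `j` is left open so that the ramified case may take v = 4.
  record Quadruple (j : Carrier) : Set (c ⊔ ℓ₁) where
    field
      v         : Carrier
      v³≈j      : v ^ 3 ≈ j
      point     : Fin 4 → Carrier
      injective : ∀ i k → point i ≈ point k → i ≡ k
      extended  : ∀ i → Extended (point i) v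

  -- The fixed points of the exchange by ζ are 1728-points: there v = 4ζ.
  fixed-point : ∀ {z l v} → z ^ 3 ≈ 1# → Quartic l v → l ^ 2 - 2 · (z * l) - 2 · z ^ 2 ≈ 0# →
    v ^ 3 ≈ (4 · 1#) ^ 3
  fixed-point {z} {l} {v} z³≈1 Q fixed = trans (cube-cong (Quartic-functional Q quartic))
    (modulo₁ z³≈1 (solve 1 (λ z → (4 :× z) :^ 3 := (4 :× con (+ 1)) :^ 3 :+
      con (+ 64) :* (z :^ 3 :- con (+ 1))) z))
    where
    quartic : Quartic l (4 · z)
    quartic = modulo₂ fixed z³≈1 (solve 2 (λ z l → let q = l :^ 2 :- 2 :× (z :* l) :- 2 :× z :^ 2 in
      l :* (l :^ 3 :+ 8 :× con (+ 1)) := 4 :× z :* (l :^ 3 :- con (+ 1))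
      :+ q :* (q :- con (+ 0)) :+ (:- (8 :× l :+ 4 :× z)) :* (z :^ 3 :- con (+ 1))) z l)

  generic-quadruple : ∀ {l v} → Quartic l v → ¬ (v ^ 3 ≈ (4 · 1#) ^ 3) → Quadruple (v ^ 3)
  generic-quadruple {l} {v} Q generic = record
    { v         = v
    ; v³≈j      = refl
    ; point     = λ k → orbit k l
    ; injective = injective
    ; extended  = λ { zero → inj₁ Q ; (suc k) → inj₁ (Quartic-exchange (ζ³≈1 k) (orbit-exchange k l³≉1) Q) }
    }
    where
    l³≉1 : ¬ (l ^ 3 ≈ 1#)
    l³≉1 = Quartic⇒l³≉1 Q

    unfixed : ∀ k → ¬ (l ≈ orbit (suc k) l)
    unfixed k eq = generic (fixed-point (ζ³≈1 k) Q (modulo₂ (orbit-exchange k l³≉1) eq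
      (solve 3 (λ z l m → l :^ 2 :- 2 :× (z :* l) :- 2 :× z :^ 2 := con (+ 0)
        :+ con (+ 1) :* (m :* (l :- z) :- z :* (l :+ 2 :× z)) :+ (l :- z) :* (l :- m)) (ζ k) l (orbit (suc k) l))))

    -- Two exchanges that agree at `l` differ by the third, which belongs to the remaining root -(z
    -- + z′) and therefore fixes `l`.
    distinct : ∀ {z z′ m} → z ^ 3 ≈ 1# → z′ ^ 3 ≈ 1# → ¬ (z ≈ z′) → Exchange z l m → ¬ Exchange z′ l m
    distinct {z} {z′} {m} z³≈1 z′³≈1 z≉z′ ex ex′ = generic (fixed-point w³≈1 Q fixed)
      where
      z-z′≉0 : ¬ (z - z′ ≈ 0#)
      z-z′≉0 eq = z≉z′ (modulo₁ eq (solve 2 (λ z z′ → z := z′ :+ con (+ 1) :* (z :- z′ :- con (+ 0))) z z′))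

      norm≈0 : z ^ 2 + z * z′ + z′ ^ 2 ≈ 0#
      norm≈0 = cancel z-z′≉0 (modulo₂ z³≈1 z′³≈1 (solve 2 (λ z z′ →
        (z :- z′) :* (z :^ 2 :+ z :* z′ :+ z′ :^ 2) := con (+ 0)
        :+ con (+ 1) :* (z :^ 3 :- con (+ 1)) :+ :- con (+ 1) :* (z′ :^ 3 :- con (+ 1))) z z′))

      w³≈1 : (- (z + z′)) ^ 3 ≈ 1#
      w³≈1 = modulo₂ norm≈0 z³≈1 (solve 2 (λ z z′ → (:- (z :+ z′)) :^ 3 := con (+ 1)
        :+ (:- (2 :× z :+ z′)) :* (z :^ 2 :+ z :* z′ :+ z′ :^ 2 :- con (+ 0))
        :+ con (+ 1) :* (z :^ 3 :- con (+ 1))) z z′)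

      fixed : l ^ 2 - 2 · (- (z + z′) * l) - 2 · (- (z + z′)) ^ 2 ≈ 0#
      fixed = modulo₁ norm≈0 (trans (cong-product (cancel z-z′≉0 (modulo₂ ex ex′ (solve 4 (λ z z′ l m →
          (z :- z′) :* (l :^ 2 :+ 2 :× ((z :+ z′) :* l) :- 2 :× (z :* z′)) := con (+ 0)
          :+ (:- (l :- z′)) :* (m :* (l :- z) :- z :* (l :+ 2 :× z))
          :+ (l :- z) :* (m :* (l :- z′) :- z′ :* (l :+ 2 :× z′))) z z′ l m))))
        (solve 2 (λ z z′ → :- (2 :× (z :^ 2 :+ z :* z′ :+ z′ :^ 2)) := con (+ 0)
          :+ (:- con (+ 2)) :* (z :^ 2 :+ z :* z′ :+ z′ :^ 2 :- con (+ 0))) z z′))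
        where
        cong-product : l ^ 2 + 2 · ((z + z′) * l) - 2 · (z * z′) ≈ 0# →
          l ^ 2 - 2 · (- (z + z′) * l) - 2 · (- (z + z′)) ^ 2 ≈ - (2 · (z ^ 2 + z * z′ + z′ ^ 2))
        cong-product eq = modulo₁ eq (solve 3 (λ z z′ l →
          l :^ 2 :- 2 :× (:- (z :+ z′) :* l) :- 2 :× (:- (z :+ z′)) :^ 2 :=
          :- (2 :× (z :^ 2 :+ z :* z′ :+ z′ :^ 2))
          :+ con (+ 1) :* (l :^ 2 :+ 2 :× ((z :+ z′) :* l) :- 2 :× (z :* z′) :- con (+ 0))) z z′ l)

    injective : ∀ i k → orbit i l ≈ orbit k l → i ≡ k
    injective zero    zero    _  = ≡.refl
    injective zero    (suc k) eq = contradiction eq (unfixed k)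
    injective (suc i) zero    eq = contradiction (sym eq) (unfixed i)
    injective (suc i) (suc k) eq with i Fin.≟ k
    ... | yes i≡k = ≡.cong suc i≡k
    ... | no  i≢k = contradiction (trans (*-congʳ eq) (orbit-exchange k l³≉1))
      (distinct (ζ³≈1 i) (ζ³≈1 k) (λ ζ≈ζ → i≢k (ζ-injective ζ≈ζ)) (orbit-exchange i l³≉1))

  module _ {x : Carrier} (x-eq : x ^ 2 - 2 · x - 2 · 1# ≈ 0#) (2≉0 : ¬ (2 · 1# ≈ 0#)) where

    -- The two double points over v = 4, which are the roots of x² - 2x - 2 and have sum 2, then the
    -- borrowed points 1 and -2, to which `Extended` assigns 4. The discriminant 12 keeps the roots
    -- apart.
    specialPoint : Fin 4 → Carrier
    specialPoint zero                   = x
    specialPoint (suc zero)             = 2 · 1# - x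
    specialPoint (suc (suc zero))       = 1#
    specialPoint (suc (suc (suc zero))) = -2#

    private
      6≉0 : ¬ (2 · 1# * 3 · 1# ≈ 0#)
      6≉0 = ≉0-* 2≉0 3≉0

      x≉2-x : ¬ (x ≈ 2 · 1# - x)
      x≉2-x eq = ≉0-* 2≉0 6≉0 (modulo₂ x-eq eq (solve 1 (λ x →
        2 :× con (+ 1) :* (2 :× con (+ 1) :* 3 :× con (+ 1)) := con (+ 0)
        :+ (:- con (+ 4)) :* (x :^ 2 :- 2 :× x :- 2 :× con (+ 1) :- con (+ 0))
        :+ (2 :× x :- con (+ 2)) :* (x :- (2 :× con (+ 1) :- x))) x))

      x≉1 : ¬ (x ≈ 1#)
      x≉1 eq = 3≉0 (modulo₂ x-eq eq (solve 1 (λ x → 3 :× con (+ 1) := con (+ 0)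
        :+ :- con (+ 1) :* (x :^ 2 :- 2 :× x :- 2 :× con (+ 1) :- con (+ 0))
        :+ (x :- con (+ 1)) :* (x :- con (+ 1))) x))

      x≉-2 : ¬ (x ≈ -2#)
      x≉-2 eq = 6≉0 (modulo₂ x-eq eq (solve 1 (λ x → 2 :× con (+ 1) :* 3 :× con (+ 1) := con (+ 0)
        :+ con (+ 1) :* (x :^ 2 :- 2 :× x :- 2 :× con (+ 1) :- con (+ 0))
        :+ (con (+ 4) :- x) :* (x :- :- (2 :× con (+ 1)))) x))

      2-x≉1 : ¬ (2 · 1# - x ≈ 1#)
      2-x≉1 eq = x≉1 (modulo₁ eq (solve 1 (λ x →
        x := con (+ 1) :+ :- con (+ 1) :* (2 :× con (+ 1) :- x :- con (+ 1))) x))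

      2-x≉-2 : ¬ (2 · 1# - x ≈ -2#)
      2-x≉-2 eq = 6≉0 (modulo₂ x-eq eq (solve 1 (λ x → 2 :× con (+ 1) :* 3 :× con (+ 1) := con (+ 0)
        :+ con (+ 1) :* (x :^ 2 :- 2 :× x :- 2 :× con (+ 1) :- con (+ 0))
        :+ (x :+ con (+ 2)) :* (2 :× con (+ 1) :- x :- :- (2 :× con (+ 1)))) x))

      1≉-2 : ¬ (1# ≈ -2#)
      1≉-2 eq = 3≉0 (modulo₁ eq (solve 0 (3 :× con (+ 1) := con (+ 0)
        :+ con (+ 1) :* (con (+ 1) :- :- (2 :× con (+ 1))))))

    specialPoint-injective : ∀ i k → specialPoint i ≈ specialPoint k → i ≡ k
    specialPoint-injective zero                   zero                   _  = ≡.refl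
    specialPoint-injective zero                   (suc zero)             eq = contradiction eq x≉2-x
    specialPoint-injective zero                   (suc (suc zero))       eq = contradiction eq x≉1
    specialPoint-injective zero                   (suc (suc (suc zero))) eq = contradiction eq x≉-2
    specialPoint-injective (suc zero)             zero                   eq = contradiction (sym eq) x≉2-x
    specialPoint-injective (suc zero)             (suc zero)             _  = ≡.refl
    specialPoint-injective (suc zero)             (suc (suc zero))       eq = contradiction eq 2-x≉1
    specialPoint-injective (suc zero)             (suc (suc (suc zero))) eq = contradiction eq 2-x≉-2
    specialPoint-injective (suc (suc zero))       zero                   eq = contradiction (sym eq) x≉1
    specialPoint-injective (suc (suc zero))       (suc zero)             eq = contradiction (sym eq) 2-x≉1
    specialPoint-injective (suc (suc zero))       (suc (suc zero))       _  = ≡.refl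
    specialPoint-injective (suc (suc zero))       (suc (suc (suc zero))) eq = contradiction eq 1≉-2
    specialPoint-injective (suc (suc (suc zero))) zero                   eq = contradiction (sym eq) x≉-2
    specialPoint-injective (suc (suc (suc zero))) (suc zero)             eq = contradiction (sym eq) 2-x≉-2
    specialPoint-injective (suc (suc (suc zero))) (suc (suc zero))       eq = contradiction (sym eq) 1≉-2
    specialPoint-injective (suc (suc (suc zero))) (suc (suc (suc zero))) _  = ≡.refl

    specialPoint-extended : ∀ i → Extended (specialPoint i) (4 · 1#)
    specialPoint-extended zero = inj₁ (modulo₁ x-eq (solve 1 (λ x → let q = x :^ 2 :- 2 :× x :- 2 :× con (+ 1) in
      x :* (x :^ 3 :+ 8 :× con (+ 1)) := 4 :× con (+ 1) :* (x :^ 3 :- con (+ 1)) :+ q :* (q :- con (+ 0))) x))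
    specialPoint-extended (suc zero) = inj₁ (modulo₁ x-eq (solve 1 (λ x → let
        q = x :^ 2 :- 2 :× x :- 2 :× con (+ 1)
        y = 2 :× con (+ 1) :- x
      in y :* (y :^ 3 :+ 8 :× con (+ 1)) := 4 :× con (+ 1) :* (y :^ 3 :- con (+ 1)) :+ q :* (q :- con (+ 0))) x))
    specialPoint-extended (suc (suc zero))       = inj₂ (inj₁ (ζ³≈1 zero , refl))
    specialPoint-extended (suc (suc (suc zero))) = inj₂ (inj₂ (refl ,
      solve 0 (4 :× con (+ 1) := :- (2 :× con (+ 1)) :* :- (2 :× con (+ 1)))))

  -- A rotation brings v to 4, where the quartic equation reads (x² - 2x - 2)² = 0. In
  -- characteristic 2 the number 64 would vanish, contrary to v being nonzero.
  special-quadruple : ∀ {l v} → Quartic l v → ¬ (v ≈ 0#) → v ^ 3 ≈ (4 · 1#) ^ 3 → Quadruple (v ^ 3)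
  special-quadruple {l} {v} Q v≉0 v³≈64 = record
    { v         = 4 · 1#
    ; v³≈j      = sym v³≈64
    ; point     = specialPoint x-eq 2≉0
    ; injective = specialPoint-injective x-eq 2≉0
    ; extended  = specialPoint-extended x-eq 2≉0
    }
    where
    root : ∃ λ i → 4 · 1# ≈ ζ i * v
    root = equal-cubes (sym v³≈64)

    x : Carrier
    x = ζ (proj₁ root) * l

    x-eq : x ^ 2 - 2 · x - 2 · 1# ≈ 0#
    x-eq = square-zero (modulo₁
      (Quartic-resp refl (sym (proj₂ root)) (Quartic-rotate (ζ³≈1 (proj₁ root)) Q))
      (solve 1 (λ x → (x :^ 2 :- 2 :× x :- 2 :× con (+ 1)) :^ 2 := con (+ 0) :+
        con (+ 1) :* (x :* (x :^ 3 :+ 8 :× con (+ 1)) :- 4 :× con (+ 1) :* (x :^ 3 :- con (+ 1)))) x))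

    2≉0 : ¬ (2 · 1# ≈ 0#)
    2≉0 2≈0 = v≉0 (cube-zero (trans v³≈64 (modulo₁ 2≈0 (solve 0 (
      (4 :× con (+ 1)) :^ 3 := con (+ 0) :+ con (+ 32) :* (2 :× con (+ 1) :- con (+ 0)))))))

  quadruple : ∀ {l v} → Quartic l v → ¬ (v ≈ 0#) → Quadruple (v ^ 3)
  quadruple {v = v} Q v≉0 with v ^ 3 ≟ (4 · 1#) ^ 3
  ... | yes special = special-quadruple Q v≉0 special
  ... | no  generic = generic-quadruple Q generic

  -- A parameter determines its nonzero extended value ζv. The cube of this gives the class,
  -- division by v then gives ζ, and what remains is a point of the quadruple.
  size*12≤order : size ℕ.* 12 ℕ.≤ order
  size*12≤order = injection⇒*-≤ (λ c k → to (point c (Fin.remQuot 4 k))) λ {c} {k} {c′} {k′} eq →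
    let c≡c′ , ik≡ik′ = point-injective c c′ (Fin.remQuot 4 k) (Fin.remQuot 4 k′) (to-injective eq)
    in c≡c′ , ≡.trans (≡.sym (Fin.combine-remQuot {3} 4 k))
         (≡.trans (≡.cong (Product.uncurry Fin.combine) ik≡ik′) (Fin.combine-remQuot {3} 4 k′))
    where
    to-injective : ∀ {x y} → to x ≡ to y → x ≈ y
    to-injective {x} {y} eq = trans (sym (from-to x)) (trans (reflexive (≡.cong from eq)) (from-to y))

    module Q (c : Fin size) = Quadruple (quadruple (Representative.quartic c) (Representative.v≉0 c))

    point : Fin size → Fin 3 × Fin 4 → Carrier
    point c (i , k) = ζ i * Q.point c k

    ζ≉0 : ∀ i → ¬ (ζ i ≈ 0#)
    ζ≉0 i ζ≈0 = 1≉0 (trans (sym (ζ³≈1 i)) (trans (*-congʳ ζ≈0) (zeroˡ _)))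

    Q³≈value : ∀ c → Q.v c ^ 3 ≈ value c
    Q³≈value c = trans (Q.v³≈j c) (Representative.v³≈value c)

    Q≉0 : ∀ c → ¬ (Q.v c ≈ 0#)
    Q≉0 c eq = value≉0 c (trans (sym (Q³≈value c)) (trans (*-congʳ eq) (zeroˡ _)))

    rotated-cube : ∀ i v → (ζ i * v) ^ 3 ≈ v ^ 3
    rotated-cube i v = modulo₁ (ζ³≈1 i)
      (solve 2 (λ z v → (z :* v) :^ 3 := v :^ 3 :+ v :^ 3 :* (z :^ 3 :- con (+ 1))) (ζ i) v)

    same-v : ∀ c c′ i k i′ k′ → point c (i , k) ≈ point c′ (i′ , k′) → ζ i * Q.v c ≈ ζ i′ * Q.v c′
    same-v c c′ i k i′ k′ eq = Extended-functional (≉0-* (ζ≉0 i) (Q≉0 c)) (≉0-* (ζ≉0 i′) (Q≉0 c′))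
      (Extended-rotate (ζ³≈1 i) (Q.extended c k))
      (Extended-resp (sym eq) (Extended-rotate (ζ³≈1 i′) (Q.extended c′ k′)))

    same-class : ∀ c c′ i k i′ k′ → point c (i , k) ≈ point c′ (i′ , k′) → c ≡ c′
    same-class c c′ i k i′ k′ eq = value-injective
      (trans (sym (Q³≈value c)) (trans (sym (rotated-cube i (Q.v c)))
      (trans (cube-cong (same-v c c′ i k i′ k′ eq))
      (trans (rotated-cube i′ (Q.v c′)) (Q³≈value c′)))))

    cancelʳ : ∀ {a x y} → ¬ (a ≈ 0#) → x * a ≈ y * a → x ≈ y
    cancelʳ {a} {x} {y} a≉0 eq = cancel-difference a≉0 (modulo₁ eq
      (solve 3 (λ a x y → a :* (x :- y) := con (+ 0) :+ con (+ 1) :* (x :* a :- y :* a)) a x y))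

    cancelˡ : ∀ {a x y} → ¬ (a ≈ 0#) → a * x ≈ a * y → x ≈ y
    cancelˡ a≉0 eq = cancelʳ a≉0 (trans (*-comm _ _) (trans eq (*-comm _ _)))

    same-position : ∀ c i k i′ k′ → point c (i , k) ≈ point c (i′ , k′) → (i , k) ≡ (i′ , k′)
    same-position c i k i′ k′ eq = ≡.cong₂ _,_ (ζ-injective ζ≈ζ)
      (Q.injective c k k′ (cancelˡ (ζ≉0 i) (trans eq (*-congʳ (sym ζ≈ζ)))))
      where
      ζ≈ζ : ζ i ≈ ζ i′
      ζ≈ζ = cancelʳ (Q≉0 c) (same-v c c i k i′ k′ eq)

    point-injective : ∀ c c′ ik ik′ → point c ik ≈ point c′ ik′ → c ≡ c′ × ik ≡ ik′
    point-injective c c′ (i , k) (i′ , k′) eq = conclude (same-class c c′ i k i′ k′ eq) eq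
      where
      conclude : ∀ {c c′} → c ≡ c′ → point c (i , k) ≈ point c′ (i′ , k′) → c ≡ c′ × (i , k) ≡ (i′ , k′)
      conclude ≡.refl eq = ≡.refl , same-position _ i k i′ k′ eq

-- The closed formula.

-- As 7 < 12, the excess q - 12n is the remainder of q, and the numerator equals 12(n + 1).
q+12∸q%12≡suc : ∀ {q n} → n ℕ.* 12 ℕ.≤ q → q ℕ.≤ n ℕ.* 12 ℕ.+ 7 → (q ℕ.+ 12 ℕ.∸ q % 12) / 12 ≡ suc n
q+12∸q%12≡suc {q} {n} lower upper = begin
  (q ℕ.+ 12 ℕ.∸ q % 12) / 12                 ≡⟨ ≡.cong (λ s → (q ℕ.+ 12 ℕ.∸ s) / 12) q%12≡r ⟩
  (q ℕ.+ 12 ℕ.∸ r) / 12                      ≡⟨ ≡.cong (λ s → (s ℕ.+ 12 ℕ.∸ r) / 12) q≡r+n*12 ⟩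
  (r ℕ.+ n ℕ.* 12 ℕ.+ 12 ℕ.∸ r) / 12         ≡⟨ ≡.cong (λ s → (s ℕ.∸ r) / 12) (ℕ.+-assoc r (n ℕ.* 12) 12) ⟩
  (r ℕ.+ (n ℕ.* 12 ℕ.+ 12) ℕ.∸ r) / 12       ≡⟨ ≡.cong (_/ 12) (ℕ.m+n∸m≡n r (n ℕ.* 12 ℕ.+ 12)) ⟩
  (n ℕ.* 12 ℕ.+ 12) / 12                     ≡⟨ ≡.cong (_/ 12) (ℕ.+-comm (n ℕ.* 12) 12) ⟩
  (suc n ℕ.* 12) / 12                        ≡⟨ ℕ.m*n/n≡m (suc n) 12 ⟩
  suc n                                      ∎
  where
  open ≡.≡-Reasoning

  r : ℕ
  r = q ℕ.∸ n ℕ.* 12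

  q≡r+n*12 : q ≡ r ℕ.+ n ℕ.* 12
  q≡r+n*12 = ≡.sym (ℕ.m∸n+n≡m lower)

  r≤7 : r ℕ.≤ 7
  r≤7 = ≡.subst (r ℕ.≤_) (ℕ.m+n∸m≡n (n ℕ.* 12) 7) (ℕ.∸-monoˡ-≤ (n ℕ.* 12) upper)

  q%12≡r : q % 12 ≡ r
  q%12≡r = ≡.trans (≡.cong (_% 12) q≡r+n*12) (≡.trans (ℕ.[m+kn]%n≡m%n r n 12)
    (ℕ.m<n⇒m%n≡m (ℕ.≤-<-trans r≤7 (ℕ.m≤m+n 8 4))))

-- The bijection between isomorphism classes and values of v³.

module Classification (F : FiniteField c ℓ₁ ℓ₂) (ρ : PrimitiveCubeRoot F) where

  open FiniteField F hiding (zero)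
  open FieldProperties F
  open EllipticCurves F
  open IsomorphismRelation F
  open CubeRootsOfUnity F ρ
  open HessePencil F ρ
  open HesseForm F ρ
  open ValueCount F ρ

  -- One choice of a Hesse parameter with its class. The choice comes from a search that
  -- isomorphisms do not respect; `index-cong`, stated for arbitrary choices, shows that the index
  -- is independent of it.
  record Parameter (E : EllipticCurve) : Set (c ⊔ ℓ₁) where
    field
      l v     : Carrier
      l³≉1    : ¬ (l ^ 3 ≈ 1#)
      iso     : E ≅ hesse l l³≉1
      quartic : Quartic l v
      index   : Fin (suc size)
      class   : Class v index

  parameter : ∀ {E} → (∃ λ l → Σ (¬ (l ^ 3 ≈ 1#)) λ l³≉1 → E ≅ hesse l l³≉1) → Parameter E
  parameter (l , l³≉1 , iso) =
    let v , quartic = Quartic-value l³≉1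
        index , class = Class-total quartic
    in record { l = l ; v = v ; l³≉1 = l³≉1 ; iso = iso ; quartic = quartic ; index = index ; class = class }

  index-cong : ∀ {E E′} (P : Parameter E) (Q : Parameter E′) → E ≅ E′ → Parameter.index P ≡ Parameter.index Q
  index-cong P Q φ = Class-functional P.index Q.index P.class Q.class
    (hesse-≅⇒v³ P.l³≉1 Q.l³≉1 P.quartic Q.quartic (≅-trans (≅-sym P.iso) (≅-trans φ Q.iso)))
    where
    module P = Parameter P
    module Q = Parameter Q

  index-injective : ∀ {E E′} (P : Parameter E) (Q : Parameter E′) → Parameter.index P ≡ Parameter.index Q → E ≅ E′
  index-injective P Q eq = ≅-trans P.iso (≅-trans
    (v³⇒hesse-≅ P.l³≉1 Q.l³≉1 P.quartic Q.quartic
      (Class-injective Q.index (≡.subst (Class P.v) eq P.class) Q.class))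
    (≅-sym Q.iso))
    where
    module P = Parameter P
    module Q = Parameter Q

  -- The parameter recorded for a Hesse curve may differ from its own `l`, but the isomorphism
  -- between the two members forces equal v³, which fixes the class.
  index-hesse : ∀ {l v k} (Q : Quartic l v) → Class v k →
    (P : Parameter (hesse l (Quartic⇒l³≉1 Q))) → Parameter.index P ≡ k
  index-hesse {k = k} Q class P = Class-functional P.index k P.class class
    (sym (hesse-≅⇒v³ (Quartic⇒l³≉1 Q) P.l³≉1 Q P.quartic P.iso))
    where module P = Parameter P

  parameter₃ : (X : NonCyclic3Torsion) → Parameter (proj₁ X)
  parameter₃ (E , ¬cyclic) = parameter (hesse-form E ¬cyclic)

  index : NonCyclic3Torsion → Fin (suc size)
  index X = Parameter.index (parameter₃ X)

  index-surjective : ∀ k → (∃ λ l → ∃ λ v → Quartic l v × Class v k) → ∃ λ X → ∀ {Z} → Z ≅₃ X → index Z ≡ k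
  index-surjective k (l , v , Q , class) = X , λ {Z} φ →
    ≡.trans (index-cong (parameter₃ Z) (parameter₃ X) φ) (index-hesse Q class (parameter₃ X))
    where
    X : NonCyclic3Torsion
    X = hesse l (Quartic⇒l³≉1 Q) , hesse-¬Cyclic l (Quartic⇒l³≉1 Q)

  classes : HasExactlyClasses _≅₃_ (suc size)
  classes = index ,
    (λ {X} {Y} → index-cong (parameter₃ X) (parameter₃ Y)) ,
    (λ {X} {Y} → index-injective (parameter₃ X) (parameter₃ Y)) ,
    (λ k → index-surjective k (Class-surjective k))

open import Data.Nat.Base using (_+_; _∸_)

proposition9 : ∀ {c ℓ₁ ℓ₂} (F : FiniteField c ℓ₁ ℓ₂) →
    let q = FiniteField.order F in
    q % 3 ≡ 1 →
    HasExactlyClasses (EllipticCurves._≅₃_ F) ((q + 12 ∸ q % 12) / 12)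
proposition9 F q%3≡1 = ≡.subst (HasExactlyClasses (EllipticCurves._≅₃_ F))
  (≡.sym (q+12∸q%12≡suc {order} {size} size*12≤order order≤)) classes
  where
  open FiniteField F using (order)
  open OrderCongruence F q%3≡1 using (primitiveCubeRoot)
  open ValueCount F primitiveCubeRoot using (size; size*12≤order; order≤)
  open Classification F primitiveCubeRoot using (classes)
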